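{- Let $n\ge 2$ be an integer and let $\lambda$ be a Young diagram with $\ell(\lambda)<n$ and $\gcd(n,|\lambda|)=1$. Let $\mathsf{C}=\langle \mathsf{c}\rangle$ be the cyclic group of order $n$ generated by $\mathsf{c}=\mathsf{s}_1\mathsf{s}_2\cdots\mathsf{s}_{n-1}$, acting on the set $\mathsf{SST}_n(\lambda)$ of semistandard tableaux of shape $\lambda$ with entries in $\{1,\dots,n\}$. Then: (1) every orbit of $\mathsf{SST}_n(\lambda)$ under the action of $\mathsf{C}$ is free (i.e. has exactly $n$ elements); (2) the triple $\bigl(\mathsf{SST}_n(\lambda),\ \mathsf{C},\ q^{ -\kappa(\lambda)}s_\lambda(1,q,\ldots,q^{n-1})\bigr)$ exhibits the cyclic sieving phenomenon.
   Context: Partitions $\lambda=(\lambda_1\ge\lambda_2\ge\cdots\ge\lambda_\ell>0)$ are identified with Young diagrams (English convention); $\ell(\lambda)=\ell$ is the number of positive parts, $|\lambda|=\sum_i\lambda_i$, and $\kappa(\lambda)=\sum_{k}(k-1)\lambda_k$. $\mathsf{SST}_n(\lambda)$ is the set of fillings of $\lambda$ with entries in $\{1,\dots,n\}$, weakly increasing along rows and strictly increasing down columns. $s_\lambda(x_1,\dots,x_n)=\sum_{T\in\mathsf{SST}_n(\lambda)}x_1^{c_1(T)}\cdots x_n^{c_n(T)}$ is the Schur polynomial, where $c_k(T)$ is the number of entries $k$ in $T$. Crystal reflections: for $1\le i\le n-1$, the operator $\mathsf{s}_i$ on $\mathsf{SST}_n(\lambda)$ comes from the standard $U_q(\mathfrak{sl}_n)$-crystal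 structure: $\mathsf{s}_i(T)=\tilde f_i^{\,c_i(T)-c_{i+1}(T)}(T)$ if $c_i(T)\ge c_{i+1}(T)$ and $\mathsf{s}_i(T)=\tilde e_i^{\,c_{i+1}(T)-c_i(T)}(T)$ otherwise. Explicitly: read the entries of $T$ row by row, each row left to right, from the bottom row to the top row; regard each $i+1$ as "(" and each $i$ as ")" and match parentheses in the usual way; the unmatched letters form a subword $i^a(i+1)^b$; $\tilde f_i$ (resp. $\tilde e_i$) changes the rightmost unmatched $i$ into $i+1$ (resp. the leftmost unmatched $i+1$ into $i$); thus $\mathsf{s}_i$ replaces the unmatched subword $i^a(i+1)^b$ by $i^b(i+1)^a$ in the same positions. It is standard that $\mathsf{s}_1,\dots,\mathsf{s}_{n-1}$ define an action of the symmetric group $\mathfrak{S}_n$ (the Weyl group) on $\mathsf{SST}_n(\lambda)$, so $\mathsf{c}=\mathsf{s}_1\mathsf{s}_2\cdots\mathsf{s}_{n-1}$ (a composition of maps, rightmost applied first) is the action of a Coxeter element of order $n$, and the cyclic group $\mathsf{C}$ of order $n$ generated by this Coxeter element acts on $\mathsf{SST}_n(\lambda)$. Cyclic sieving phenomenon: for $d\ge1$ let $\omega_d$ be a primitive $d$-th root of unity. If $X$ is a finite set with an action of a finite cyclic group $C$ and $f(q)$ is a polynomial with nonnegative integer coefficients, then $(X,C,f(q))$ exhibits the cyclic sieving phenomenon if $\#\{x\in X: gx=x\}=f(\omega_{o(g)})$ for all $g\in C$, where $o(g)$ is the order of $g$ in $C$. -}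

module Defs where

open import Level using (Level; 0ℓ; _⊔_) renaming (suc to lsuc)
open import Algebra.Bundles using (RawSemiring; Semiring; CommutativeRing)
open import Algebra.Apartness.Bundles using (HeytingField; HeytingCommutativeRing)
import Algebra.Definitions.RawSemiring as RawSemiringDefs
open import Data.Bool.Base using (Bool; true; false; if_then_else_)
open import Data.List.Base
  using (List; []; _∷_; length; map; foldr; concat; reverse; take; drop; filter;
         zipWith; upTo; applyUpTo; cartesianProductWith)
open import Data.List.Membership.Propositional using (_∈_)
open import Data.List.Relation.Binary.Prefix.Heterogeneous using (Prefix)
open import Data.List.Relation.Binary.Prefix.Heterogeneous.Properties using (prefix?)
open import Data.List.Relation.Unary.All using (All; all?)
open import Data.List.Relation.Unary.Linked using (Linked; linked?)
open import Data.List.Relation.Unary.Unique.Propositional using (Unique)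
open import Data.Nat.Base using (ℕ; zero; suc; _+_; _*_; _∸_; _≤_; _<_; _≥_; _>_; _≤ᵇ_)
open import Data.Nat.Divisibility using (_∣_)
open import Data.Nat.ListAction using (sum)
open import Data.Nat.Properties using (_≟_; _≤?_; _>?_)
open import Data.Product.Base using (_×_; _,_; ∃-syntax)
open import Function.Base using (id; _∘_)
open import Function.Bundles using (_⇔_)
import Function.Endo.Propositional as Endo
open import Relation.Binary.PropositionalEquality.Core using (_≡_)
open import Relation.Nullary.Decidable.Core using (yes; no; _×-dec_)
open import Relation.Nullary.Negation.Core using (¬_)
open import Relation.Unary using (Pred; Decidable)

private
  variable
    a c ℓ ℓ₁ ℓ₂ : Level
    A : Set a

IsPartition : Pred (List ℕ) 0ℓ
IsPartition μ = Linked _≥_ μ × All (0 <_) μ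

κ : List ℕ → ℕ
κ μ = sum (zipWith _*_ (upTo (length μ)) μ)

-- The list of rows, top row first.
Filling : Set
Filling = List (List ℕ)

interval : ℕ → List ℕ
interval n = applyUpTo suc n

-- Consecutive rows, aligned on the left.
Above : List ℕ → List ℕ → Set
Above upper lower = Prefix _>_ lower upper

Semistandard : Pred Filling 0ℓ
Semistandard T = All (Linked _≤_) T × Linked Above T

semistandard? : Decidable Semistandard
semistandard? T =
  all? (linked? _≤?_) T ×-dec linked? (λ upper lower → prefix? _>?_ lower upper) T

SST : ℕ → List ℕ → Pred Filling 0ℓ
SST n μ T = map length T ≡ μ × All (All (λ e → 1 ≤ e × e ≤ n)) T × Semistandard T

words : ℕ → ℕ → List (List ℕ)
words n zero    = [] ∷ []
words n (suc l) = cartesianProductWith _∷_ (interval n) (words n l)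

fillings : ℕ → List ℕ → List Filling
fillings n []      = [] ∷ []
fillings n (l ∷ μ) = cartesianProductWith _∷_ (words n l) (fillings n μ)

-- The elements of SST n μ, each listed once.
tableaux : ℕ → List ℕ → List Filling
tableaux n μ = filter semistandard? (fillings n μ)

content : ℕ → Filling → ℕ
content k T = length (filter (_≟ k) (concat T))

-- Words are scanned from the left, the letter o being an opening bracket
-- and c a closing one; h counts the opening brackets still pending.
module Brackets (o c : ℕ) where

  data Kind : Set where
    opening closing neutral : Kind

  kind : ℕ → Kind
  kind x with x ≟ o | x ≟ c
  ... | yes _ | _     = opening
  ... | no _  | yes _ = closing
  ... | no _  | no _  = neutral

  hasUnmatchedClosing : ℕ → List ℕ → Bool
  hasUnmatchedClosing h [] = false
  hasUnmatchedClosing h (x ∷ w) with kind x | h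
  ... | opening | _      = hasUnmatchedClosing (suc h) w
  ... | closing | zero   = true
  ... | closing | suc h′ = hasUnmatchedClosing h′ w
  ... | neutral | _      = hasUnmatchedClosing h w

  -- Turns the rightmost unmatched closing letter into an opening one; a
  -- word without unmatched closing letters is left as it is.
  flipLast : ℕ → List ℕ → List ℕ
  flipLast h [] = []
  flipLast h (x ∷ w) with kind x | h
  ... | opening | _      = x ∷ flipLast (suc h) w
  ... | closing | zero   = if hasUnmatchedClosing 0 w then x ∷ flipLast 0 w else o ∷ w
  ... | closing | suc h′ = x ∷ flipLast h′ w
  ... | neutral | _      = x ∷ flipLast h w

f-word : ℕ → List ℕ → List ℕ
f-word i = Brackets.flipLast (suc i) i 0

-- Seen from the right, each i opens and each i + 1 closes, and the
-- leftmost unmatched i + 1 comes last.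
e-word : ℕ → List ℕ → List ℕ
e-word i w = reverse (Brackets.flipLast i (suc i) 0 (reverse w))

chop : List ℕ → List ℕ → List (List ℕ)
chop []       w = []
chop (l ∷ ls) w = take l w ∷ chop ls (drop l w)

-- Applies a length-preserving map of words to the reading word (rows from
-- bottom to top, each from left to right), keeping the shape.
onReading : (List ℕ → List ℕ) → Filling → Filling
onReading F T = reverse (chop (map length rows) (F (concat rows)))
  where rows = reverse T

-- The exponents used in s below never exceed the number of unmatched
-- letters available, so the fallback case of flipLast plays no role there.
f̃ ẽ : ℕ → Filling → Filling
f̃ i = onReading (f-word i)
ẽ i = onReading (e-word i)

infixr 8 _^^_
_^^_ : (A → A) → ℕ → A → A
_^^_ {A = A} = Endo._^_ A

s : ℕ → Filling → Filling
s i T = if content (suc i) T ≤ᵇ content i T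
        then (f̃ i ^^ (content i T ∸ content (suc i) T)) T
        else (ẽ i ^^ (content (suc i) T ∸ content i T)) T

-- s 1 ∘ s 2 ∘ ⋯ ∘ s (n - 1)
coxeter : ℕ → Filling → Filling
coxeter n = foldr (λ i g → s i ∘ g) id (interval (n ∸ 1))

module _ (R : RawSemiring c ℓ) where
  open RawSemiring R renaming (_+_ to _+ᴿ_; _*_ to _*ᴿ_)
  open RawSemiringDefs R using (_^_)

  -- x k is the value of the k-th variable, 1 ≤ k ≤ n.
  schur : (n : ℕ) → List ℕ → (ℕ → Carrier) → Carrier
  schur n μ x = foldr (λ T acc → weight T +ᴿ acc) 0# (tableaux n μ)
    where
    weight : Filling → Carrier
    weight T = foldr (λ k acc → (x k ^ content k T) *ᴿ acc) 1# (interval n)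

-- Polynomials in q, constant coefficient first.
Poly : Set
Poly = List ℕ

coeff : Poly → ℕ → ℕ
coeff []      _       = 0
coeff (b ∷ f) zero    = b
coeff (b ∷ f) (suc k) = coeff f k

-- Lists are only compared up to trailing zeros.
infix 4 _≈ₚ_
_≈ₚ_ : Poly → Poly → Set
f ≈ₚ g = ∀ k → coeff f k ≡ coeff g k

infixl 6 _+ₚ_
_+ₚ_ : Poly → Poly → Poly
[]      +ₚ g       = g
(b ∷ f) +ₚ []      = b ∷ f
(b ∷ f) +ₚ (d ∷ g) = (b + d) ∷ (f +ₚ g)

infixl 7 _*ₚ_
_*ₚ_ : Poly → Poly → Poly
[]      *ₚ g = []
(b ∷ f) *ₚ g = map (b *_) g +ₚ (0 ∷ (f *ₚ g))

ℕ[q] : RawSemiring 0ℓ 0ℓ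
ℕ[q] = record
  { Carrier = Poly
  ; _≈_     = _≈ₚ_
  ; _+_     = _+ₚ_
  ; _*_     = _*ₚ_
  ; 0#      = []
  ; 1#      = 1 ∷ []
  }

infixr 8 q^_
q^_ : ℕ → Poly
q^ k = RawSemiringDefs._^_ ℕ[q] (0 ∷ 1 ∷ []) k

module InField (K : HeytingField c ℓ₁ ℓ₂) where
  open HeytingField K using (Carrier; _≈_; 0#; 1#)
    renaming (_+_ to _+ᴷ_; _*_ to _*ᴷ_)

  private
    ring : CommutativeRing c ℓ₁
    ring = HeytingCommutativeRing.commutativeRing (HeytingField.heytingCommutativeRing K)

  open RawSemiringDefs (Semiring.rawSemiring (CommutativeRing.semiring ring))
    using (_^_) renaming (_×_ to _·_)

  fromℕ : ℕ → Carrier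
  fromℕ m = m · 1#

  CharacteristicZero : Set ℓ₁
  CharacteristicZero = ∀ m → 0 < m → ¬ (fromℕ m ≈ 0#)

  IsPrimitiveRoot : ℕ → Carrier → Set ℓ₁
  IsPrimitiveRoot d ω =
    0 < d × ω ^ d ≈ 1# × (∀ k → 0 < k → k < d → ¬ (ω ^ k ≈ 1#))

  eval : Poly → Carrier → Carrier
  eval []      x = 0#
  eval (b ∷ f) x = fromℕ b +ᴷ x *ᴷ eval f x

_HasSize_ : {A : Set a} → Pred A ℓ → ℕ → Set (a ⊔ ℓ)
P HasSize m = ∃[ xs ] (Unique xs × (∀ x → x ∈ xs ⇔ P x) × length xs ≡ m)

-- The cyclic group of order n with generator γ acts on X, with γ acting as
-- g; the element γᵏ then acts as g ^^ k.
record IsCyclicAction {A : Set a} (X : Pred A ℓ) (n : ℕ) (g : A → A) : Set (a ⊔ ℓ) where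
  field
    closed : ∀ x → X x → X (g x)
    period : ∀ x → X x → (g ^^ n) x ≡ x

Orbit : {A : Set a} → (A → A) → A → Pred A a
Orbit g x y = ∃[ k ] ((g ^^ k) x ≡ y)

Fixed : {A : Set a} → Pred A ℓ → (A → A) → Pred A (a ⊔ ℓ)
Fixed X h x = X x × h x ≡ x

-- d is the order of γᵏ in the cyclic group of order n generated by γ.
HasOrder : (n k d : ℕ) → Set
HasOrder n k d =
  0 < d × n ∣ d * k × (∀ e → 0 < e → n ∣ e * k → d ≤ e)

-- The complex numbers are replaced by an arbitrary field of characteristic
-- zero; the number m of fixed points does not depend on it.
record CyclicSieving (c ℓ₁ ℓ₂ : Level) {A : Set a} (X : Pred A ℓ)
                     (n : ℕ) (g : A → A) (f : Poly)
                     : Set (a ⊔ ℓ ⊔ lsuc (c ⊔ ℓ₁ ⊔ ℓ₂)) where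
  field
    action : IsCyclicAction X n g
    sieve  : ∀ k d → HasOrder n k d →
             ∃[ m ] (Fixed X (g ^^ k) HasSize m ×
                     (∀ (K : HeytingField c ℓ₁ ℓ₂) → let open InField K in
                      CharacteristicZero → ∀ ω → IsPrimitiveRoot d ω →
                      HeytingField._≈_ K (eval f ω) (fromℕ m)))

{-# OPTIONS --safe #-}
-- The Coxeter element shifts contents cyclically, so that modulo n it increases the degree
-- ∑ (entry - 1) by |λ|, a unit modulo n. Hence a power of it fixing a tableau is trivial, and the
-- value S of q^(-κ) s_λ(1, q, …, q^(n-1)) at a primitive d-th root of unity ω, d ∣ n, satisfies
-- S = ω^|λ| S, whence S = 0 for d > 1.
--
-- That the Coxeter element has order n follows from the Coxeter relations, which hold on all words.
-- For the braid relation, restrict to three consecutive letters: reflections preserve the recording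
-- tableau of row insertion, and a word is determined by its recording tableau, its content and the
-- string length ε₁. Since ε₁ + ε₂ only depends on shape and content, and since each reflection shifts
-- its own ε by a difference of contents, both sides of the braid relation have the same ε₁.
module Submission where

open import Defs
open import Algebra.Apartness.Bundles using (HeytingCommutativeRing; HeytingField)
open import Algebra.Bundles using (CommutativeRing; Semiring)
import Algebra.Definitions.RawSemiring as RawSemiringDefs
import Algebra.Properties.Monoid.Mult as MonoidMult
import Algebra.Properties.Ring as RingProperties
import Algebra.Properties.Semiring.Exp as SemiringExp
open import Data.Bool.Base using (T; false; if_then_else_; true)
open import Data.Empty using (⊥-elim)
open import Data.List.Base
  using (List; []; [_]; _++_; _∷_; _∷ʳ_; applyUpTo; concat; drop; filter; foldr; length; map;
         reverse; take; zipWith)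
open import Data.List.Membership.Propositional using (_∈_)
open import Data.List.Membership.Propositional.Properties
open import Data.List.Membership.Propositional.Properties.WithK using (unique∧set⇒bag)
open import Data.List.Properties
  using (++-assoc; ++-identityʳ; applyUpTo-∷ʳ; concat-++; filter-++; filter-accept; filter-all;
         filter-none; filter-reject; length-++; length-applyUpTo; length-drop; length-reverse;
         length-take; map-++; reverse-++; reverse-involutive; reverse-map; take++drop≡id;
         unfold-reverse; ∷-injective)
open import Data.List.Relation.Binary.BagAndSetEquality using (∼bag⇒↭)
open import Data.List.Relation.Binary.Permutation.Propositional using (_↭_; prep; swap; ↭-sym)
open import Data.List.Relation.Binary.Permutation.Propositional.Properties using (All-resp-↭; ↭-reverse)
open import Data.List.Relation.Binary.Pointwise as Pointwise using (Pointwise; []; _∷_)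
open import Data.List.Relation.Binary.Prefix.Heterogeneous using ([]; _∷_)
open import Data.List.Relation.Unary.All as All using (All; []; _∷_)
import Data.List.Relation.Unary.All.Properties as All
open import Data.List.Relation.Unary.AllPairs using (AllPairs; []; _∷_)
open import Data.List.Relation.Unary.Any using (here; there)
open import Data.List.Relation.Unary.Linked using (Linked; [-]; []; _∷_)
open import Data.List.Relation.Unary.Linked.Properties using (Linked⇒AllPairs)
open import Data.List.Relation.Unary.Unique.Propositional using (Unique)
import Data.List.Relation.Unary.Unique.Propositional.Properties as Unique
open import Data.Nat.Base hiding (_^_)
open import Data.Nat.Coprimality using (coprime-divisor; gcd≡1⇒coprime)
open import Data.Nat.DivMod using (_%_; _/_; m%n<n; m≡m%n+[m/n]*n)
open import Data.Nat.Divisibility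
open import Data.Nat.GCD using (gcd; gcd-greatest)
open import Data.Nat.ListAction using (sum)
open import Data.Nat.ListAction.Properties using (sum-++)
open import Data.Nat.Properties
open import Data.Nat.Tactic.RingSolver using (solve-∀)
open import Data.Product.Base using (_,_; _×_; proj₁; proj₂; ∃-syntax)
open import Data.Sum.Base using (_⊎_; inj₁; inj₂)
open import Data.Unit.Base using (tt)
open import Function.Base using (_∘_; case_of_; flip; id)
open import Function.Bundles using (Equivalence; _⇔_; mk⇔)
open import Level using (Level)
open import Relation.Binary.Definitions using (tri<; tri>; tri≈)
open import Relation.Binary.PropositionalEquality
  using (_≡_; _≢_; cong; cong₂; module ≡-Reasoning; refl; subst; subst₂; sym; trans)
import Relation.Binary.Reasoning.Setoid as SetoidReasoning
open import Relation.Nullary.Decidable.Core using (no; yes)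
open import Relation.Nullary.Negation.Core using (¬_)

-- Matching of brackets

-- All properties of the reflections except semistandardness are proved for words: a shape enters
-- only through the row lengths at which a word is cut, and these never change. A reflection sees
-- just two letters, so three letters carry the braid relation, with foreign letters kept as inert
-- marks in the recording. The obstacle to the braid relation is multiplicity. Two sides with equal
-- shape and content need not coincide, since in three letters the tableaux of given shape and
-- content form a one-parameter family; ε₁ is a coordinate on it. The second reflection changes ε₁
-- in a way that brackets do not show directly, which is why the sum ε₁ + ε₂ is brought in. The
-- congruence for the degree comes from the contents: the multiplicity of each k < n passes to k + 1
-- and that of n passes to 1, so the degree gains 1 for each entry below n and loses n - 1 for each
-- entry n, which is again a gain of 1 modulo n. For the trivial power d = 1 and the polynomial
-- counts all tableaux; for any other power the root-of-unity value and the number of fixed points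
-- are both 0.

Word : Set
Word = List ℕ

module BracketStatistics (o c : ℕ) where
  open Brackets o c public

  after : Kind → ℕ → ℕ
  after opening h = suc h
  after closing h = pred h
  after neutral h = h

  lone : Kind → ℕ → ℕ
  lone closing zero = 1
  lone _       _    = 0

  pending : ℕ → Word → ℕ
  pending h []      = h
  pending h (x ∷ w) = pending (after (kind x) h) w

  unmatched : ℕ → Word → ℕ
  unmatched h []      = 0
  unmatched h (x ∷ w) = lone (kind x) h + unmatched (after (kind x) h) w

  -- One relation serves both crystal operators: the displayed `c` is the last unmatched closing
  -- letter of the first word and, by the same two conditions, the displayed `o` is the first
  -- unmatched opening letter of the second.
  data Flip : Word → Word → Set where
    flip-at : ∀ u v → pending 0 u ≡ 0 → unmatched 0 v ≡ 0 → Flip (u ++ c ∷ v) (u ++ o ∷ v)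

  pending-++ : ∀ h u v → pending h (u ++ v) ≡ pending (pending h u) v
  pending-++ h []      v = refl
  pending-++ h (x ∷ u) v = pending-++ (after (kind x) h) u v

  unmatched-++ : ∀ h u v → unmatched h (u ++ v) ≡ unmatched h u + unmatched (pending h u) v
  unmatched-++ h []      v = refl
  unmatched-++ h (x ∷ u) v =
    trans (cong (lone (kind x) h +_) (unmatched-++ (after (kind x) h) u v))
          (sym (+-assoc (lone (kind x) h) _ _))

  -- An additional pending bracket absorbs one lone closing letter, if there is any. In
  -- `pending-suc` the same event is seen from the bracket, which survives only when there is no
  -- such letter.
  unmatched-suc : ∀ h w → unmatched (suc h) w ≡ pred (unmatched h w)
  unmatched-suc h [] = refl
  unmatched-suc h (x ∷ w) with kind x | h
  ... | opening | h      = unmatched-suc (suc h) w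
  ... | closing | zero   = refl
  ... | closing | suc h′ = unmatched-suc h′ w
  ... | neutral | h      = unmatched-suc h w

  pending-suc : ∀ h w → pending (suc h) w ≡ pending h w + (1 ∸ unmatched h w)
  pending-suc h [] = sym (+-comm h 1)
  pending-suc h (x ∷ w) with kind x | h
  ... | opening | h      = pending-suc (suc h) w
  ... | closing | zero   = sym (trans (cong (pending 0 w +_) (0∸n≡0 (unmatched 0 w))) (+-identityʳ _))
  ... | closing | suc h′ = pending-suc h′ w
  ... | neutral | h      = pending-suc h w

  -- The final number of pending brackets is monotone in the initial one. This brings a condition on
  -- the whole reading word down to two adjacent rows.
  pending-suffix : ∀ u v → pending 0 v ≤ pending 0 (u ++ v)
  pending-suffix u v = subst (_ ≤_) (sym (pending-++ 0 u v)) (mono (pending 0 u))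
    where
    mono : ∀ h → pending 0 v ≤ pending h v
    mono zero    = ≤-refl
    mono (suc h) = ≤-trans (mono h) (≤-trans (m≤m+n _ _) (≤-reflexive (sym (pending-suc h v))))

  hasUnmatched-false : ∀ h w → unmatched h w ≡ 0 → hasUnmatchedClosing h w ≡ false
  hasUnmatched-false h [] eq = refl
  hasUnmatched-false h (x ∷ w) eq with kind x | h
  ... | opening | _      = hasUnmatched-false _ w eq
  ... | closing | suc h′ = hasUnmatched-false _ w eq
  ... | neutral | _      = hasUnmatched-false _ w eq

  hasUnmatched-true : ∀ h w → 0 < unmatched h w → hasUnmatchedClosing h w ≡ true
  hasUnmatched-true h (x ∷ w) lt with kind x | h
  ... | opening | _      = hasUnmatched-true _ w lt
  ... | closing | zero   = refl
  ... | closing | suc h′ = hasUnmatched-true _ w lt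
  ... | neutral | _      = hasUnmatched-true _ w lt

  kind-closing : ∀ x → kind x ≡ closing → x ≡ c
  kind-closing x eq with x ≟ o | x ≟ c
  kind-closing x () | yes _ | _
  kind-closing x eq | no _ | yes p = p
  kind-closing x () | no _ | no _

  kind-opening : ∀ x → kind x ≡ opening → x ≡ o
  kind-opening x eq with x ≟ o | x ≟ c
  kind-opening x eq | yes p | _ = p
  kind-opening x () | no _ | yes _
  kind-opening x () | no _ | no _

  kind-o : kind o ≡ opening
  kind-o with o ≟ o | o ≟ c
  ... | yes _ | _ = refl
  ... | no ¬p | _ = ⊥-elim (¬p refl)

  kind-c : c ≢ o → kind c ≡ closing
  kind-c c≢o with c ≟ o | c ≟ c
  ... | yes p | _     = ⊥-elim (c≢o p)
  ... | no _  | yes _ = refl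
  ... | no _  | no ¬p = ⊥-elim (¬p refl)

  kind-neutral : ∀ x → x ≢ o → x ≢ c → kind x ≡ neutral
  kind-neutral x x≢o x≢c with x ≟ o | x ≟ c
  ... | yes p | _     = ⊥-elim (x≢o p)
  ... | no _  | yes p = ⊥-elim (x≢c p)
  ... | no _  | no _  = refl

  -- The induction needs every `h`, because the scan enters the tail with whatever is pending; the
  -- count in `v` restarts from 0 because nothing is pending at an unmatched closing letter.
  flipLast-splits : ∀ h w → 0 < unmatched h w → ∃[ u ] ∃[ v ]
    (w ≡ u ++ c ∷ v × flipLast h w ≡ u ++ o ∷ v × pending h u ≡ 0 × unmatched 0 v ≡ 0)
  flipLast-splits h (x ∷ w) lt with kind x in eq | h
  ... | opening | h = let (u , v , p , q , r , s) = flipLast-splits (suc h) w lt in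
    x ∷ u , v , cong (x ∷_) p , cong (x ∷_) q , trans (cong (λ k → pending (after k h) u) eq) r , s
  ... | closing | suc h′ = let (u , v , p , q , r , s) = flipLast-splits h′ w lt in
    x ∷ u , v , cong (x ∷_) p , cong (x ∷_) q , trans (cong (λ k → pending (after k (suc h′)) u) eq) r , s
  ... | neutral | h = let (u , v , p , q , r , s) = flipLast-splits h w lt in
    x ∷ u , v , cong (x ∷_) p , cong (x ∷_) q , trans (cong (λ k → pending (after k h) u) eq) r , s
  ... | closing | zero with unmatched 0 w in eq₀
  ...   | zero rewrite hasUnmatched-false 0 w eq₀ =
          [] , w , cong (_∷ w) (kind-closing x eq) , refl , refl , eq₀
  ...   | suc m rewrite hasUnmatched-true 0 w (subst (0 <_) (sym eq₀) z<s) =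
          let (u , v , p , q , r , s) = flipLast-splits 0 w (subst (0 <_) (sym eq₀) z<s) in
          x ∷ u , v , cong (x ∷_) p , cong (x ∷_) q , trans (cong (λ k → pending (after k 0) u) eq) r , s

  flipLast-flips : ∀ w → 0 < unmatched 0 w → Flip w (flipLast 0 w)
  flipLast-flips w lt with flipLast-splits 0 w lt
  ... | u , v , p , q , r , s = subst (λ z → Flip z (flipLast 0 w)) (sym p)
                                  (subst (Flip _) (sym q) (flip-at u v r s))

-- Duality of brackets under reversal of words

module _ (o c : ℕ) (c≢o : c ≢ o) where
  private
    module F = BracketStatistics o c
    module B = BracketStatistics c o

  data Dual : F.Kind → B.Kind → Set where
    opening : Dual F.opening B.closing
    closing : Dual F.closing B.opening
    neutral : Dual F.neutral B.neutral

  dual : ∀ x → Dual (F.kind x) (B.kind x)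
  dual x with x ≟ o | x ≟ c
  ... | yes refl | yes p = ⊥-elim (c≢o (sym p))
  ... | yes _    | no _  = opening
  ... | no _     | yes _ = closing
  ... | no _     | no _  = neutral

  -- The matched pairs are the same from either end; only the names opening and closing are
  -- exchanged, and with them the two kinds of leftover letters.
  reverse-brackets : ∀ w → B.pending 0 (reverse w) ≡ F.unmatched 0 w ×
                           B.unmatched 0 (reverse w) ≡ F.pending 0 w
  reverse-brackets [] = refl , refl
  reverse-brackets (x ∷ w)
    rewrite unfold-reverse x w
          | B.pending-++ 0 (reverse w) (x ∷ [])
          | B.unmatched-++ 0 (reverse w) (x ∷ [])
          | proj₁ (reverse-brackets w) | proj₂ (reverse-brackets w)
    with F.kind x | B.kind x | dual x
  ... | _ | _ | opening = sym (F.unmatched-suc 0 w) ,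
          trans (cong (F.pending 0 w +_) (trans (+-identityʳ _) (lone-pred (F.unmatched 0 w)))) (sym (F.pending-suc 0 w))
    where
    lone-pred : ∀ m → B.lone B.closing m ≡ 1 ∸ m
    lone-pred zero    = refl
    lone-pred (suc m) = sym (0∸n≡0 m)
  ... | _ | _ | closing = refl , +-identityʳ _
  ... | _ | _ | neutral = refl , +-identityʳ _

  -- This subsumes the raising operator: `e-word` flips the reversed word with the brackets
  -- exchanged, so undoing it is a flip in the original orientation.
  reverse-flip : ∀ {w w′} → B.Flip w w′ → F.Flip (reverse w′) (reverse w)
  reverse-flip (B.flip-at u v p q)
    rewrite reverse-++ u (o ∷ v) | reverse-++ u (c ∷ v)
          | unfold-reverse o v | unfold-reverse c v
          | ++-assoc (reverse v) (o ∷ []) (reverse u)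
          | ++-assoc (reverse v) (c ∷ []) (reverse u)
    = F.flip-at (reverse v) (reverse u) (trans (sym (proj₁ (rev v))) q) (trans (sym (proj₂ (rev u))) p)
    where
    rev : ∀ z → B.unmatched 0 z ≡ F.pending 0 (reverse z) × B.pending 0 z ≡ F.unmatched 0 (reverse z)
    rev z with reverse-brackets (reverse z)
    ... | a , b rewrite reverse-involutive z = b , a

-- The reflections on words

count : ℕ → Word → ℕ
count k w = length (filter (_≟ k) w)

count-++ : ∀ k u v → count k (u ++ v) ≡ count k u + count k v
count-++ k u v = trans (cong length (filter-++ (_≟ k) u v)) (length-++ (filter (_≟ k) u))

count-here : ∀ k w → count k (k ∷ w) ≡ suc (count k w)
count-here k w = cong length (filter-accept (_≟ k) refl)

count-there : ∀ {k x} w → x ≢ k → count k (x ∷ w) ≡ count k w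
count-there w x≢k = cong length (filter-reject (_≟ _) x≢k)

count-middle : ∀ k u v → count k (u ++ k ∷ v) ≡ suc (count k u + count k v)
count-middle k u v = trans (count-++ k u (k ∷ v)) (trans (cong (count k u +_) (count-here k v)) (+-suc _ _))

module Letter (i : ℕ) where
  open BracketStatistics (suc i) i public

  -- The string lengths of the crystal, that is, how often `f-word i` and `e-word i` can act by a
  -- genuine flip.
  φ ε : Word → ℕ
  φ = unmatched 0
  ε = pending 0

  i≢1+i : i ≢ suc i
  i≢1+i ()

  1+i≢i : suc i ≢ i
  1+i≢i ()

  -- Every pair consists of one closing `i` and one opening bracket, the latter being a letter
  -- `suc i` or one of the `h` initial ones; counting the leftovers gives the balance. At `h = 0` it
  -- is the weight identity of the crystal: `φ` minus `ε` is the difference of the two counts.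
  count-brackets : ∀ h w → count i w + pending h w ≡ count (suc i) w + unmatched h w + h
  count-brackets h [] = refl
  count-brackets h (x ∷ w) with kind x in eq
  ... | opening with refl ← kind-opening x eq
          rewrite count-here (suc i) w | count-there w 1+i≢i =
          trans (count-brackets (suc h) w) (+-suc _ h)
  ... | neutral rewrite count-there {suc i} {x} w (λ { refl → case trans (sym eq) kind-o of λ () })
                      | count-there {i} {x} w (λ { refl → case trans (sym eq) (kind-c i≢1+i) of λ () })
                = count-brackets h w
  ... | closing with refl ← kind-closing x eq
          rewrite count-here i w | count-there w i≢1+i with h
  ...   | zero = trans (cong suc (count-brackets 0 w)) (sym (cong (_+ 0) (+-suc _ _)))
  ...   | suc h = trans (cong suc (count-brackets h w)) (sym (+-suc _ h))

  φ-flip : ∀ {w w′} → Flip w w′ → φ w ≡ suc (φ w′)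
  φ-flip (flip-at u v p q)
    rewrite unmatched-++ 0 u (i ∷ v) | unmatched-++ 0 u (suc i ∷ v) | p | kind-o | kind-c i≢1+i
          | q | unmatched-suc 0 v | q = trans (+-suc _ 0) refl

  ε-flip : ∀ {w w′} → Flip w w′ → ε w′ ≡ suc (ε w)
  ε-flip (flip-at u v p q)
    rewrite pending-++ 0 u (i ∷ v) | pending-++ 0 u (suc i ∷ v) | p | kind-o | kind-c i≢1+i
          | pending-suc 0 v | q = +-comm _ 1

  count-i-flip : ∀ {w w′} → Flip w w′ → count i w ≡ suc (count i w′)
  count-i-flip (flip-at u v p q)
    rewrite count-middle i u v | count-++ i u (suc i ∷ v) | count-there v 1+i≢i = refl

  count-1+i-flip : ∀ {w w′} → Flip w w′ → count (suc i) w′ ≡ suc (count (suc i) w)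
  count-1+i-flip (flip-at u v p q)
    rewrite count-++ (suc i) u (i ∷ v) | count-middle (suc i) u v | count-there v i≢1+i = refl

  count-other-flip : ∀ {k w w′} → k ≢ i → k ≢ suc i → Flip w w′ → count k w ≡ count k w′
  count-other-flip {k} k≢i k≢1+i (flip-at u v p q)
    rewrite count-++ k u (i ∷ v) | count-++ k u (suc i ∷ v)
          | count-there v (k≢i ∘ sym) | count-there v (k≢1+i ∘ sym) = refl

  length-flip : ∀ {w w′} → Flip w w′ → length w ≡ length w′
  length-flip (flip-at u v p q) = trans (length-++ u) (sym (length-++ u))

  data Moves : ℕ → Word → Word → Set where
    stay : ∀ {w} → Moves 0 w w
    move : ∀ {k w w′ w″} → Flip w w′ → Moves k w′ w″ → Moves (suc k) w w″

  move-last : ∀ {k w w′ w″} → Moves k w w′ → Flip w′ w″ → Moves (suc k) w w″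
  move-last stay       q = move q stay
  move-last (move p m) q = move p (move-last m q)

  moves-lower : (g : Word → ℕ) → (∀ {w w′} → Flip w w′ → g w ≡ suc (g w′)) →
                ∀ {k w w′} → Moves k w w′ → g w ≡ k + g w′
  moves-lower g dec stay       = refl
  moves-lower g dec (move p m) = trans (dec p) (cong suc (moves-lower g dec m))

  moves-raise : (g : Word → ℕ) → (∀ {w w′} → Flip w w′ → g w′ ≡ suc (g w)) →
                ∀ {k w w′} → Moves k w w′ → g w′ ≡ k + g w
  moves-raise g inc stay       = refl
  moves-raise g inc (move {k} p m) = trans (moves-raise g inc m) (trans (cong (k +_) (inc p)) (+-suc k _))

  f-flip : ∀ w → 0 < φ w → Flip w (f-word i w)
  f-flip = flipLast-flips

  e-flip : ∀ w → 0 < ε w → Flip (e-word i w) w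
  e-flip w lt = subst (Flip _) (reverse-involutive w)
    (reverse-flip (suc i) i i≢1+i
      (BracketStatistics.flipLast-flips i (suc i) (reverse w)
        (subst (0 <_) (sym (proj₂ (reverse-brackets (suc i) i i≢1+i w))) lt)))

  private
    rest-positive : ∀ k {a b} → a ≡ k + b → k < a → 0 < b
    rest-positive k refl k<a = +-cancelˡ-< k 0 _ (≤-<-trans (≤-reflexive (+-identityʳ k)) k<a)

  f-moves : ∀ k w → k ≤ φ w → Moves k w ((f-word i ^^ k) w)
  f-moves zero    w k≤φ = stay
  f-moves (suc k) w k<φ = move-last m (f-flip _ (rest-positive k (moves-lower φ φ-flip m) k<φ))
    where m = f-moves k w (<⇒≤ k<φ)

  e-moves : ∀ k w → k ≤ ε w → Moves k ((e-word i ^^ k) w) w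
  e-moves zero    w k≤ε = stay
  e-moves (suc k) w k<ε = move (e-flip _ (rest-positive k (moves-raise ε ε-flip m) k<ε)) m
    where m = e-moves k w (<⇒≤ k<ε)

  count-excess : ∀ w → count i w + ε w ≡ count (suc i) w + φ w
  count-excess w = trans (count-brackets 0 w) (+-identityʳ _)

s-word : ℕ → Word → Word
s-word i w = if count (suc i) w ≤ᵇ count i w
             then (f-word i ^^ (count i w ∸ count (suc i) w)) w
             else (e-word i ^^ (count (suc i) w ∸ count i w)) w

private
  excess-bound : ∀ {a b p q} → a + p ≡ b + q → b ≤ a → a ∸ b ≤ q
  excess-bound {a} {b} {p} {q} eq b≤a = ≤-trans (∸-monoˡ-≤ b (≤-trans (m≤m+n a p) (≤-reflexive eq))) (≤-reflexive (m+n∸m≡n b q))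

module _ (i : ℕ) where
  open Letter i

  -- By `count-excess` the exponent in `s-word` is at most the string length, so each step is a
  -- genuine flip. The second case is a chain from `s-word i w` to `w`, so that both cases are made
  -- of flips in the lowering direction.
  s-word-moves : ∀ w →
    (count (suc i) w ≤ count i w × Moves (count i w ∸ count (suc i) w) w (s-word i w)) ⊎
    (count i w ≤ count (suc i) w × Moves (count (suc i) w ∸ count i w) (s-word i w) w)
  s-word-moves w with count (suc i) w ≤ᵇ count i w in eq
  ... | true  = inj₁ (le , f-moves _ w (excess-bound (count-excess w) le))
    where le = ≤ᵇ⇒≤ _ _ (subst T (sym eq) tt)
  ... | false = inj₂ (ge , e-moves _ w (excess-bound (sym (count-excess w)) ge))
    where ge = ≰⇒≥ (λ le → subst T eq (≤⇒≤ᵇ le))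

  -- A preorder that contains the flips in both directions contains the graph of the reflection. It
  -- is used with equality of an invariant, with agreement away from given letters, and with the
  -- transfer of semistandardness.
  s-word-preserves : ∀ {ℓ} (R : Word → Word → Set ℓ) →
    (∀ {w} → R w w) → (∀ {u v w} → R u v → R v w → R u w) →
    (∀ {w w′} → Flip w w′ → R w w′) → (∀ {w w′} → Flip w w′ → R w′ w) →
    ∀ w → R w (s-word i w)
  s-word-preserves R rfl tr fwd bwd w with s-word-moves w
  ... | inj₁ (_ , m) = forth m
    where
    forth : ∀ {k w w′} → Moves k w w′ → R w w′
    forth stay       = rfl
    forth (move p m) = tr (fwd p) (forth m)
  ... | inj₂ (_ , m) = back m
    where
    back : ∀ {k w w′} → Moves k w w′ → R w′ w
    back stay       = rfl
    back (move p m) = tr (back m) (bwd p)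

  s-word-invariant : ∀ {a} {A : Set a} (g : Word → A) → (∀ {w w′} → Flip w w′ → g w ≡ g w′) →
                     ∀ w → g (s-word i w) ≡ g w
  s-word-invariant g inv w = sym (s-word-preserves (λ u v → g u ≡ g v) refl trans inv (sym ∘ inv) w)

  -- The number of flips is a difference of counts whose sign depends on the direction; with one
  -- count on each side, a single equation without subtraction covers both directions.
  s-word-raise : (g : Word → ℕ) → (∀ {w w′} → Flip w w′ → g w′ ≡ suc (g w)) →
                 ∀ w → g (s-word i w) + count (suc i) w ≡ g w + count i w
  s-word-raise g inc w with s-word-moves w
  ... | inj₁ (le , m) = trans (cong (_+ count (suc i) w) (trans (moves-raise g inc m) (+-comm _ (g w))))
                          (trans (+-assoc (g w) _ _) (cong (g w +_) (m∸n+n≡m le)))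
  ... | inj₂ (le , m) = sym (trans (cong (_+ count i w) (trans (moves-raise g inc m) (+-comm _ (g (s-word i w)))))
                          (trans (+-assoc (g (s-word i w)) _ _) (cong (g (s-word i w) +_) (m∸n+n≡m le))))

  s-word-lower : (g : Word → ℕ) → (∀ {w w′} → Flip w w′ → g w ≡ suc (g w′)) →
                 ∀ w → g w + count (suc i) w ≡ g (s-word i w) + count i w
  s-word-lower g dec w with s-word-moves w
  ... | inj₁ (le , m) = trans (cong (_+ count (suc i) w) (trans (moves-lower g dec m) (+-comm _ (g (s-word i w)))))
                          (trans (+-assoc (g (s-word i w)) _ _) (cong (g (s-word i w) +_) (m∸n+n≡m le)))
  ... | inj₂ (le , m) = sym (trans (cong (_+ count i w) (trans (moves-lower g dec m) (+-comm _ (g w))))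
                          (trans (+-assoc (g w) _ _) (cong (g w +_) (m∸n+n≡m le))))

  count-i-s-word : ∀ w → count i (s-word i w) ≡ count (suc i) w
  count-i-s-word w = +-cancelʳ-≡ (count i w) _ _
    (trans (sym (s-word-lower (count i) count-i-flip w)) (+-comm (count i w) _))

  count-1+i-s-word : ∀ w → count (suc i) (s-word i w) ≡ count i w
  count-1+i-s-word w = +-cancelʳ-≡ (count (suc i) w) _ _
    (trans (s-word-raise (count (suc i)) count-1+i-flip w) (+-comm (count (suc i) w) _))

  count-other-s-word : ∀ {k} → k ≢ i → k ≢ suc i → ∀ w → count k (s-word i w) ≡ count k w
  count-other-s-word k≢i k≢1+i = s-word-invariant (count _) (count-other-flip k≢i k≢1+i)

  length-s-word : ∀ w → length (s-word i w) ≡ length w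
  length-s-word = s-word-invariant length length-flip

  φ-s-word : ∀ w → φ (s-word i w) ≡ ε w
  φ-s-word w = +-cancelʳ-≡ (count i w) _ _ (begin
    φ (s-word i w) + count i w ≡⟨ s-word-lower φ φ-flip w ⟨
    φ w + count (suc i) w      ≡⟨ +-comm (φ w) _ ⟩
    count (suc i) w + φ w      ≡⟨ count-excess w ⟨
    count i w + ε w            ≡⟨ +-comm (count i w) _ ⟩
    ε w + count i w            ∎)
    where open ≡-Reasoning

  ε-s-word : ∀ w → ε (s-word i w) ≡ φ w
  ε-s-word w = +-cancelʳ-≡ (count (suc i) w) _ _ (begin
    ε (s-word i w) + count (suc i) w ≡⟨ s-word-raise ε ε-flip w ⟩
    ε w + count i w                  ≡⟨ +-comm (ε w) _ ⟩
    count i w + ε w                  ≡⟨ count-excess w ⟩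
    count (suc i) w + φ w            ≡⟨ +-comm (count (suc i) w) _ ⟩
    φ w + count (suc i) w            ∎)
    where open ≡-Reasoning

-- Insertion of words in three letters

-- tab u g h v q c is the semistandard tableau in three letters with rows
-- 1^(u+v+c) 2^g 3^h, 2^(v+c) 3^q and 3^c.
data Tab : Set where
  tab : (u g h v q c : ℕ) → Tab

data Role : Set where
  one two three : Role
  other         : ℕ → Role

-- A foreign letter leaves the tableau alone but is recorded with its value, so that insertion
-- remains reversible on words with arbitrary letters.
data Row : Set where
  row₁ row₂ row₃ : Row
  outside        : ℕ → Row

-- Row insertion with the bumping carried out: a 1 pushes a 2 out of the first row if there is one
-- and otherwise a 3, a 2 pushes out a 3, and a 2 arriving in the second row pushes a 3 into the
-- third.
insert : Role → Tab → Tab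
insert one       (tab u zero    zero    v q       c) = tab (suc u) 0 0 v q c
insert one       (tab u zero    (suc h) v q       c) = tab (suc u) 0 h v (suc q) c
insert one       (tab u (suc g) h       v zero    c) = tab u g h (suc v) 0 c
insert one       (tab u (suc g) h       v (suc q) c) = tab u g h v q (suc c)
insert two       (tab u g       zero    v q       c) = tab u (suc g) 0 v q c
insert two       (tab u g       (suc h) v q       c) = tab u (suc g) h v (suc q) c
insert three     (tab u g       h       v q       c) = tab u g (suc h) v q c
insert (other _) t                                   = t

newBox : Role → Tab → Row
newBox one       (tab u zero    zero    v q       c) = row₁
newBox one       (tab u zero    (suc h) v q       c) = row₂
newBox one       (tab u (suc g) h       v zero    c) = row₂
newBox one       (tab u (suc g) h       v (suc q) c) = row₃
newBox two       (tab u g       zero    v q       c) = row₁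
newBox two       (tab u g       (suc h) v q       c) = row₂
newBox three     _                                   = row₁
newBox (other x) _                                   = outside x

-- Reverse bumping. It has to be a left inverse of insertion only, so its values are arbitrary where
-- `pred` truncates or where the named row has no removable box.
remove : Row → Tab → Role × Tab
remove row₁        (tab u g       (suc h) v q       c) = three , tab u g h v q c
remove row₁        (tab u (suc g) zero    v q       c) = two , tab u g 0 v q c
remove row₁        (tab u zero    zero    v q       c) = one , tab (pred u) 0 0 v q c
remove row₂        (tab u g       h       v zero    c) = one , tab u (suc g) h (pred v) 0 c
remove row₂        (tab u zero    h       v (suc q) c) = one , tab (pred u) 0 (suc h) v q c
remove row₂        (tab u (suc g) h       v (suc q) c) = two , tab u g (suc h) v q c
remove row₃        (tab u g       h       v q       c) = one , tab u (suc g) h v (suc q) (pred c)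
remove (outside x) t                                   = other x , t

remove-insert : ∀ r t → remove (newBox r t) (insert r t) ≡ (r , t)
remove-insert one       (tab u zero    zero    v q       c) = refl
remove-insert one       (tab u zero    (suc h) v q       c) = refl
remove-insert one       (tab u (suc g) h       v zero    c) = refl
remove-insert one       (tab u (suc g) h       v (suc q) c) = refl
remove-insert two       (tab u g       zero    v q       c) = refl
remove-insert two       (tab u g       (suc h) v q       c) = refl
remove-insert three     (tab u g       h       v q       c) = refl
remove-insert (other _) t                                   = refl

insert-injective : ∀ {r t r′ t′} → newBox r t ≡ newBox r′ t′ → insert r t ≡ insert r′ t′ →
                   (r , t) ≡ (r′ , t′)
insert-injective {r} {t} {r′} {t′} eq₁ eq₂ =
  trans (sym (remove-insert r t)) (trans (cong₂ remove eq₁ eq₂) (remove-insert r′ t′))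

row₁-length row₂-length row₃-length count-one count-two : Tab → ℕ
row₁-length (tab u g h v q c) = u + v + c + g + h
row₂-length (tab u g h v q c) = v + c + q
row₃-length (tab u g h v q c) = c
count-one   (tab u g h v q c) = u + v + c
count-two   (tab u g h v q c) = g + v + c

box₁ box₂ box₃ : Row → ℕ
box₁ row₁ = 1
box₁ _    = 0
box₂ row₂ = 1
box₂ _    = 0
box₃ row₃ = 1
box₃ _    = 0

ones twos : Role → ℕ
ones one = 1
ones _   = 0
twos two = 1
twos _   = 0

row₁-insert : ∀ r t → row₁-length (insert r t) ≡ box₁ (newBox r t) + row₁-length t
row₁-insert one       (tab u zero    zero    v q       c) = refl
row₁-insert one       (tab u zero    (suc h) v q       c) = lem u v c h
  where
  lem : ∀ u v c h → suc u + v + c + 0 + h ≡ u + v + c + 0 + suc h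
  lem = solve-∀
row₁-insert one       (tab u (suc g) h       v zero    c) = lem u v c g h
  where
  lem : ∀ u v c g h → u + suc v + c + g + h ≡ u + v + c + suc g + h
  lem = solve-∀
row₁-insert one       (tab u (suc g) h       v (suc q) c) = lem u v c g h
  where
  lem : ∀ u v c g h → u + v + suc c + g + h ≡ u + v + c + suc g + h
  lem = solve-∀
row₁-insert two       (tab u g       zero    v q       c) = lem u v c g
  where
  lem : ∀ u v c g → u + v + c + suc g + 0 ≡ 1 + (u + v + c + g + 0)
  lem = solve-∀
row₁-insert two       (tab u g       (suc h) v q       c) = lem u v c g h
  where
  lem : ∀ u v c g h → u + v + c + suc g + h ≡ u + v + c + g + suc h
  lem = solve-∀
row₁-insert three     (tab u g       h       v q       c) = +-suc _ h
row₁-insert (other _) t                                   = refl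

row₂-insert : ∀ r t → row₂-length (insert r t) ≡ box₂ (newBox r t) + row₂-length t
row₂-insert one       (tab u zero    zero    v q       c) = refl
row₂-insert one       (tab u zero    (suc h) v q       c) = +-suc _ q
row₂-insert one       (tab u (suc g) h       v zero    c) = refl
row₂-insert one       (tab u (suc g) h       v (suc q) c) = lem v c q
  where
  lem : ∀ v c q → v + suc c + q ≡ v + c + suc q
  lem = solve-∀
row₂-insert two       (tab u g       zero    v q       c) = refl
row₂-insert two       (tab u g       (suc h) v q       c) = +-suc _ q
row₂-insert three     (tab u g       h       v q       c) = refl
row₂-insert (other _) t                                   = refl

row₃-insert : ∀ r t → row₃-length (insert r t) ≡ box₃ (newBox r t) + row₃-length t
row₃-insert one       (tab u zero    zero    v q       c) = refl
row₃-insert one       (tab u zero    (suc h) v q       c) = refl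
row₃-insert one       (tab u (suc g) h       v zero    c) = refl
row₃-insert one       (tab u (suc g) h       v (suc q) c) = refl
row₃-insert two       (tab u g       zero    v q       c) = refl
row₃-insert two       (tab u g       (suc h) v q       c) = refl
row₃-insert three     (tab u g       h       v q       c) = refl
row₃-insert (other _) t                                   = refl

count-one-insert : ∀ r t → count-one (insert r t) ≡ ones r + count-one t
count-one-insert one       (tab u zero    zero    v q       c) = refl
count-one-insert one       (tab u zero    (suc h) v q       c) = refl
count-one-insert one       (tab u (suc g) h       v zero    c) = cong (_+ c) (+-suc u v)
count-one-insert one       (tab u (suc g) h       v (suc q) c) = +-suc _ c
count-one-insert two       (tab u g       zero    v q       c) = refl
count-one-insert two       (tab u g       (suc h) v q       c) = refl
count-one-insert three     (tab u g       h       v q       c) = refl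
count-one-insert (other _) t                                   = refl

count-two-insert : ∀ r t → count-two (insert r t) ≡ twos r + count-two t
count-two-insert one       (tab u zero    zero    v q       c) = refl
count-two-insert one       (tab u zero    (suc h) v q       c) = refl
count-two-insert one       (tab u (suc g) h       v zero    c) = cong (_+ c) (+-suc g v)
count-two-insert one       (tab u (suc g) h       v (suc q) c) = +-suc _ c
count-two-insert two       (tab u g       zero    v q       c) = refl
count-two-insert two       (tab u g       (suc h) v q       c) = refl
count-two-insert three     (tab u g       h       v q       c) = refl
count-two-insert (other _) t                                   = refl

-- These are the leftovers in the row reading 3^c 2^(v+c) 3^q 1^(u+v+c) 2^g 3^h. When 2 opens and 1
-- closes, the second row is closed by the first and 2^g remains. When 3 opens and 2 closes, 3^c is
-- closed by the second row and 3^q by 2^g as far as possible, while 3^h remains.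
ε₁ ε₂ : Tab → ℕ
ε₁ (tab u g h v q c) = g
ε₂ (tab u g h v q c) = h + (q ∸ g)

-- Shape and content give five linear equations in six parameters. Since `ε₁` is the parameter g
-- itself, adding it makes the system triangular: c and g are given, then v, u, h and q follow in
-- turn.
tab-determined : ∀ t t′ → row₁-length t ≡ row₁-length t′ → row₂-length t ≡ row₂-length t′ →
  row₃-length t ≡ row₃-length t′ → count-one t ≡ count-one t′ → count-two t ≡ count-two t′ →
  ε₁ t ≡ ε₁ t′ → t ≡ t′
tab-determined (tab u g h v q c) (tab u′ .g h′ v′ q′ .c) a b refl n₁ n₂ refl
  with refl ← +-cancelˡ-≡ g v v′ (+-cancelʳ-≡ c _ _ n₂)
  with refl ← +-cancelʳ-≡ v u u′ (+-cancelʳ-≡ c _ _ n₁)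
  with refl ← +-cancelˡ-≡ _ h h′ a
  with refl ← +-cancelˡ-≡ _ q q′ b
  = refl

m⊔n≡m+[n∸m] : ∀ m n → m ⊔ n ≡ m + (n ∸ m)
m⊔n≡m+[n∸m] zero    n       = refl
m⊔n≡m+[n∸m] (suc m) zero    = sym (+-identityʳ _)
m⊔n≡m+[n∸m] (suc m) (suc n) = cong suc (m⊔n≡m+[n∸m] m n)

-- The sum ε₁ + ε₂ only depends on the shape and the content of the tableau.
ε-sum : ∀ t → ε₁ t + ε₂ t + count-one t + count-two t ≡ row₁-length t + (row₂-length t ⊔ count-two t)
ε-sum (tab u g h v q c) = begin
  g + (h + (q ∸ g)) + (u + v + c) + (g + v + c)          ≡⟨ lem u g h v c (q ∸ g) ⟩
  (u + v + c + g + h) + ((v + c) + (g + (q ∸ g)))        ≡⟨ cong (λ z → (u + v + c + g + h) + ((v + c) + z)) (m⊔n≡m+[n∸m] g q) ⟨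
  (u + v + c + g + h) + ((v + c) + (g ⊔ q))              ≡⟨ cong ((u + v + c + g + h) +_) (+-distribˡ-⊔ (v + c) g q) ⟩
  (u + v + c + g + h) + ((v + c + g) ⊔ (v + c + q))      ≡⟨ cong ((u + v + c + g + h) +_) (⊔-comm (v + c + g) _) ⟩
  (u + v + c + g + h) + ((v + c + q) ⊔ (v + c + g))      ≡⟨ cong (λ z → (u + v + c + g + h) + ((v + c + q) ⊔ z)) (lem′ v c g) ⟩
  (u + v + c + g + h) + ((v + c + q) ⊔ (g + v + c))      ∎
  where
  open ≡-Reasoning
  lem : ∀ u g h v c d → g + (h + d) + (u + v + c) + (g + v + c) ≡ (u + v + c + g + h) + ((v + c) + (g + d))
  lem = solve-∀
  lem′ : ∀ v c g → v + c + g ≡ g + v + c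
  lem′ = solve-∀

-- The graphs of the crystal operators f̃₁ and f̃₂.
data Lower₁ : Tab → Tab → Set where
  in-row₁ : ∀ {u g h v q c} → Lower₁ (tab (suc u) g h v q c) (tab u (suc g) h v q c)

data Lower₂ : Tab → Tab → Set where
  in-row₁ : ∀ {u g h v q c} → q ≤ g → Lower₂ (tab u (suc g) h v q c) (tab u g (suc h) v q c)
  in-row₂ : ∀ {u g h v q c} → g ≤ q → Lower₂ (tab u g h (suc v) q c) (tab (suc u) g h v (suc q) c)

-- Insertion commutes with the lowering operator as long as the new letter does not become an
-- unmatched 1, which would be the one to be lowered instead. The hypothesis provides a pending 2
-- for an inserted 1.
insert-lower₁ : ∀ r {t t′} → Lower₁ t t′ → (r ≡ one → 0 < ε₁ t) →
  Lower₁ (insert r t) (insert r t′) × newBox r t ≡ newBox r t′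
insert-lower₁ one (in-row₁ {g = zero}) pos with () ← pos refl
insert-lower₁ one (in-row₁ {g = suc g} {q = zero})  pos = in-row₁ , refl
insert-lower₁ one (in-row₁ {g = suc g} {q = suc q}) pos = in-row₁ , refl
insert-lower₁ two (in-row₁ {h = zero})  pos = in-row₁ , refl
insert-lower₁ two (in-row₁ {h = suc h}) pos = in-row₁ , refl
insert-lower₁ three     in-row₁ pos = in-row₁ , refl
insert-lower₁ (other _) in-row₁ pos = in-row₁ , refl

insert-lower₂ : ∀ r {t t′} → Lower₂ t t′ → (r ≡ two → 0 < ε₂ t) →
  Lower₂ (insert r t) (insert r t′) × newBox r t ≡ newBox r t′
insert-lower₂ one (in-row₁ {g = zero} {q = zero} z≤n)            pos = in-row₂ z≤n , refl
insert-lower₂ one (in-row₁ {g = suc g} {q = zero} z≤n)           pos = in-row₁ z≤n , refl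
insert-lower₂ one (in-row₁ {g = suc g} {q = suc q} (s≤s q≤g))    pos = in-row₁ q≤g , refl
insert-lower₂ one (in-row₂ {g = zero} {h = zero} g≤q)            pos = in-row₂ z≤n , refl
insert-lower₂ one (in-row₂ {g = zero} {h = suc h} g≤q)           pos = in-row₂ z≤n , refl
insert-lower₂ one (in-row₂ {g = suc g} {q = suc q} (s≤s g≤q))    pos = in-row₂ g≤q , refl
insert-lower₂ two (in-row₁ {h = zero} q≤g) pos
  with () ← <-irrefl (sym (m≤n⇒m∸n≡0 (m≤n⇒m≤1+n q≤g))) (pos refl)
insert-lower₂ two (in-row₁ {h = suc h} q≤g)                      pos = in-row₁ (s≤s q≤g) , refl
insert-lower₂ two (in-row₂ {h = zero} g≤q)                       pos = in-row₂ (∸-positive (pos refl)) , refl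
  where
  ∸-positive : ∀ {g q} → 0 < q ∸ g → g < q
  ∸-positive {g} {q} lt = ≰⇒> (λ q≤g → <-irrefl (sym (m≤n⇒m∸n≡0 q≤g)) lt)
insert-lower₂ two (in-row₂ {h = suc h} g≤q)                      pos = in-row₂ (s≤s g≤q) , refl
insert-lower₂ three (in-row₁ q≤g)                                pos = in-row₁ q≤g , refl
insert-lower₂ three (in-row₂ g≤q)                                pos = in-row₂ g≤q , refl
insert-lower₂ (other _) l                                        pos = l , refl

-- This is the situation at the flipped letter, where the two words part. That nothing is pending
-- there, the first condition of `Flip`, makes the 1 and the 2 push out the same entry, if any.
create-lower₁ : ∀ t → ε₁ t ≡ 0 → Lower₁ (insert one t) (insert two t) × newBox one t ≡ newBox two t
create-lower₁ (tab u .zero zero    v q c) refl = in-row₁ , refl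
create-lower₁ (tab u .zero (suc h) v q c) refl = in-row₁ , refl

create-lower₂ : ∀ t → ε₂ t ≡ 0 → Lower₂ (insert two t) (insert three t) × newBox two t ≡ newBox three t
create-lower₂ (tab u g zero v q c) eq = in-row₁ (m∸n≡0⇒m≤n eq) , refl

-- Insertion and recording of words; reflections preserve the recording

module Insertion (j : ℕ) where

  role : ℕ → Role
  role x with x ≟ j | x ≟ suc j | x ≟ suc (suc j)
  ... | yes _ | _     | _     = one
  ... | no _  | yes _ | _     = two
  ... | no _  | no _  | yes _ = three
  ... | no _  | no _  | no _  = other x

  data HasRole : ℕ → Role → Set where
    is-one   : HasRole j one
    is-two   : HasRole (suc j) two
    is-three : HasRole (suc (suc j)) three
    is-other : ∀ {x} → x ≢ j → x ≢ suc j → x ≢ suc (suc j) → HasRole x (other x)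

  hasRole : ∀ x → HasRole x (role x)
  hasRole x with x ≟ j | x ≟ suc j | x ≟ suc (suc j)
  ... | yes refl | _        | _        = is-one
  ... | no _     | yes refl | _        = is-two
  ... | no _     | no _     | yes refl = is-three
  ... | no p     | no q     | no r     = is-other p q r

  role-injective : ∀ x y → role x ≡ role y → x ≡ y
  role-injective x y eq with role x | hasRole x | role y | hasRole y
  role-injective x y refl | one     | is-one         | _ | is-one         = refl
  role-injective x y refl | two     | is-two         | _ | is-two         = refl
  role-injective x y refl | three   | is-three       | _ | is-three       = refl
  role-injective x y refl | other _ | is-other _ _ _ | _ | is-other _ _ _ = refl

  role-j : role j ≡ one
  role-j with role j | hasRole j
  ... | _ | is-one         = refl
  ... | _ | is-other p _ _ = ⊥-elim (p refl)

  role-1+j : role (suc j) ≡ two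
  role-1+j with role (suc j) | hasRole (suc j)
  ... | _ | is-two         = refl
  ... | _ | is-other _ p _ = ⊥-elim (p refl)

  role-2+j : role (suc (suc j)) ≡ three
  role-2+j with role (suc (suc j)) | hasRole (suc (suc j))
  ... | _ | is-three       = refl
  ... | _ | is-other _ _ p = ⊥-elim (p refl)

  insertWord : Tab → Word → Tab
  insertWord t []      = t
  insertWord t (x ∷ w) = insertWord (insert (role x) t) w

  -- The recording tableau as a lattice word: instead of placing the numbers 1, 2, ... in boxes, it
  -- lists the row in which each of them would be placed.
  recording : Tab → Word → List Row
  recording t []      = []
  recording t (x ∷ w) = newBox (role x) t ∷ recording (insert (role x) t) w

  recording-++ : ∀ t u v → recording t (u ++ v) ≡ recording t u ++ recording (insertWord t u) v
  recording-++ t []      v = refl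
  recording-++ t (x ∷ u) v = cong (newBox (role x) t ∷_) (recording-++ (insert (role x) t) u v)

  -- Reverse insertion: the recursive call comes first, so the letters are undone from the last one
  -- back to the head.
  insertion-injective : ∀ t w t′ w′ → recording t w ≡ recording t′ w′ →
    insertWord t w ≡ insertWord t′ w′ → t ≡ t′ × w ≡ w′
  insertion-injective t []      t′ []        eq₁ eq₂ = eq₂ , refl
  insertion-injective t (x ∷ w) t′ (x′ ∷ w′) eq₁ eq₂
    with eq , eqs ← ∷-injective eq₁
    with eq₃ , refl ← insertion-injective _ w _ w′ eqs eq₂
    = let eq₄ = insert-injective eq eq₃
      in cong proj₂ eq₄ , cong (_∷ w) (role-injective x x′ (cong proj₁ eq₄))

  insertWord-boxes : (m : Tab → ℕ) (b : Row → ℕ) → (∀ r t → m (insert r t) ≡ b (newBox r t) + m t) →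
                     ∀ t w → m (insertWord t w) ≡ sum (map b (recording t w)) + m t
  insertWord-boxes m b step t []      = refl
  insertWord-boxes m b step t (x ∷ w) = begin
    m (insertWord (insert (role x) t) w) ≡⟨ insertWord-boxes m b step _ w ⟩
    s′ + m (insert (role x) t)           ≡⟨ cong (s′ +_) (step (role x) t) ⟩
    s′ + (b₀ + m t)                      ≡⟨ lem s′ b₀ (m t) ⟩
    b₀ + s′ + m t                        ∎
    where
    open ≡-Reasoning
    s′ = sum (map b (recording (insert (role x) t) w))
    b₀ = b (newBox (role x) t)
    lem : ∀ a b c → a + (b + c) ≡ b + a + c
    lem = solve-∀

  insertWord-letters : (m : Tab → ℕ) (b : Role → ℕ) (k : ℕ) → (∀ r t → m (insert r t) ≡ b r + m t) →
                       (∀ x w → count k (x ∷ w) ≡ b (role x) + count k w) →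
                       ∀ t w → m (insertWord t w) ≡ count k w + m t
  insertWord-letters m b k step cnt t []      = refl
  insertWord-letters m b k step cnt t (x ∷ w) = begin
    m (insertWord (insert (role x) t) w) ≡⟨ insertWord-letters m b k step cnt _ w ⟩
    count k w + m (insert (role x) t)    ≡⟨ cong (count k w +_) (step (role x) t) ⟩
    count k w + (b (role x) + m t)       ≡⟨ lem (count k w) (b (role x)) (m t) ⟩
    b (role x) + count k w + m t         ≡⟨ cong (_+ m t) (cnt x w) ⟨
    count k (x ∷ w) + m t                ∎
    where
    open ≡-Reasoning
    lem : ∀ a b c → a + (b + c) ≡ b + a + c
    lem = solve-∀

  count-one-insertWord : ∀ t w → count-one (insertWord t w) ≡ count j w + count-one t
  count-one-insertWord = insertWord-letters count-one ones j count-one-insert cnt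
    where
    cnt : ∀ x w → count j (x ∷ w) ≡ ones (role x) + count j w
    cnt x w with role x | hasRole x
    ... | _ | is-one         = count-here j w
    ... | _ | is-two         = count-there {x = suc j} w (λ ())
    ... | _ | is-three       = count-there {x = suc (suc j)} w (λ ())
    ... | _ | is-other p _ _ = count-there w p

  count-two-insertWord : ∀ t w → count-two (insertWord t w) ≡ count (suc j) w + count-two t
  count-two-insertWord = insertWord-letters count-two twos (suc j) count-two-insert cnt
    where
    cnt : ∀ x w → count (suc j) (x ∷ w) ≡ twos (role x) + count (suc j) w
    cnt x w with role x | hasRole x
    ... | _ | is-one         = count-there {x = j} w (λ ())
    ... | _ | is-two         = count-here (suc j) w
    ... | _ | is-three       = count-there {x = suc (suc j)} w (λ ())
    ... | _ | is-other _ p _ = count-there w p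

  private
    module L₁ = Letter j
    module L₂ = Letter (suc j)

  -- That insertion preserves string lengths is seen letter by letter: `ε₁` of the growing tableau
  -- obeys the update rule of the bracket counter. The same holds for `ε₂`, whose truncated
  -- difference matches the `pred` of that rule.
  ε₁-insert : ∀ x t → ε₁ (insert (role x) t) ≡ L₁.after (L₁.kind x) (ε₁ t)
  ε₁-insert x t with role x | hasRole x
  ε₁-insert x (tab u zero    zero    v q       c) | _ | is-one rewrite L₁.kind-c L₁.i≢1+i = refl
  ε₁-insert x (tab u zero    (suc h) v q       c) | _ | is-one rewrite L₁.kind-c L₁.i≢1+i = refl
  ε₁-insert x (tab u (suc g) h       v zero    c) | _ | is-one rewrite L₁.kind-c L₁.i≢1+i = refl
  ε₁-insert x (tab u (suc g) h       v (suc q) c) | _ | is-one rewrite L₁.kind-c L₁.i≢1+i = refl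
  ε₁-insert x (tab u g       zero    v q       c) | _ | is-two rewrite L₁.kind-o = refl
  ε₁-insert x (tab u g       (suc h) v q       c) | _ | is-two rewrite L₁.kind-o = refl
  ε₁-insert x (tab u g       h       v q       c) | _ | is-three
    rewrite L₁.kind-neutral (suc (suc j)) (λ ()) (λ ()) = refl
  ε₁-insert x t | _ | is-other p q _ rewrite L₁.kind-neutral x q p = refl

  ε₂-insert : ∀ x t → ε₂ (insert (role x) t) ≡ L₂.after (L₂.kind x) (ε₂ t)
  ε₂-insert x t with role x | hasRole x
  ε₂-insert x (tab u g h v q c) | _ | is-one rewrite L₂.kind-neutral j (λ ()) (λ ()) = lem g h q
    where
    lem : ∀ g h q → ε₂ (insert one (tab u g h v q c)) ≡ h + (q ∸ g)
    lem zero    zero    q       = refl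
    lem zero    (suc h) q       = +-suc h q
    lem (suc g) h       zero    = cong (h +_) (0∸n≡0 g)
    lem (suc g) h       (suc q) = refl
  ε₂-insert x (tab u g zero    v q c) | _ | is-two rewrite L₂.kind-c L₂.i≢1+i = sym (pred[m∸n]≡m∸[1+n] q g)
  ε₂-insert x (tab u g (suc h) v q c) | _ | is-two rewrite L₂.kind-c L₂.i≢1+i = refl
  ε₂-insert x (tab u g h       v q c) | _ | is-three rewrite L₂.kind-o = refl
  ε₂-insert x t | _ | is-other _ p q rewrite L₂.kind-neutral x q p = refl

  ε₁-insertWord : ∀ t w → ε₁ (insertWord t w) ≡ L₁.pending (ε₁ t) w
  ε₁-insertWord t []      = refl
  ε₁-insertWord t (x ∷ w) = trans (ε₁-insertWord _ w) (cong (λ h → L₁.pending h w) (ε₁-insert x t))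

  ε₂-insertWord : ∀ t w → ε₂ (insertWord t w) ≡ L₂.pending (ε₂ t) w
  ε₂-insertWord t []      = refl
  ε₂-insertWord t (x ∷ w) = trans (ε₂-insertWord _ w) (cong (λ h → L₂.pending h w) (ε₂-insert x t))

  -- If `w` has no unmatched closing letter, each 1 meets a positive `ε₁`, as `insert-lower₁`
  -- requires. So the two tableaux remain one lowering step apart and grow by the same boxes.
  lower₁-recording : ∀ w {t t′} → Lower₁ t t′ → L₁.unmatched (ε₁ t) w ≡ 0 → recording t w ≡ recording t′ w
  lower₁-recording [] l eq = refl
  lower₁-recording (x ∷ w) {t} l eq =
    let l′ , same = insert-lower₁ (role x) l positive
    in cong₂ _∷_ same (lower₁-recording w l′
         (trans (cong (λ h → L₁.unmatched h w) (ε₁-insert x t)) (m+n≡0⇒n≡0 _ eq)))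
    where
    positive : role x ≡ one → 0 < ε₁ t
    positive p with refl ← role-injective x j (trans p (sym role-j))
      with ε₁ t | subst (λ k → L₁.lone k (ε₁ t) ≡ 0) (L₁.kind-c L₁.i≢1+i) (m+n≡0⇒m≡0 _ eq)
    ... | suc _ | _ = z<s

  lower₂-recording : ∀ w {t t′} → Lower₂ t t′ → L₂.unmatched (ε₂ t) w ≡ 0 → recording t w ≡ recording t′ w
  lower₂-recording [] l eq = refl
  lower₂-recording (x ∷ w) {t} l eq =
    let l′ , same = insert-lower₂ (role x) l positive
    in cong₂ _∷_ same (lower₂-recording w l′
         (trans (cong (λ h → L₂.unmatched h w) (ε₂-insert x t)) (m+n≡0⇒n≡0 _ eq)))
    where
    positive : role x ≡ two → 0 < ε₂ t
    positive p with refl ← role-injective x (suc j) (trans p (sym role-1+j))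
      with ε₂ t | subst (λ k → L₂.lone k (ε₂ t) ≡ 0) (L₂.kind-c L₂.i≢1+i) (m+n≡0⇒m≡0 _ eq)
    ... | suc _ | _ = z<s

  empty : Tab
  empty = tab 0 0 0 0 0 0

  tableau : Word → Tab
  tableau = insertWord empty

  flip₁-recording : ∀ {w w′} → L₁.Flip w w′ → recording empty w ≡ recording empty w′
  flip₁-recording (L₁.flip-at u v p q)
    rewrite recording-++ empty u (j ∷ v) | recording-++ empty u (suc j ∷ v) | role-j | role-1+j =
    let t = tableau u
        ε≡0 = trans (ε₁-insertWord empty u) p
        l , same = create-lower₁ t ε≡0
    -- The lone letter leaves `ε₁` at 0, which is the starting value in the condition that `Flip`
    -- puts on `v`.
    in cong (recording empty u ++_) (cong₂ _∷_ same (lower₁-recording v l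
         (trans (cong (λ h → L₁.unmatched h v) (ε-one t ε≡0)) q)))
    where
    ε-one : ∀ t → ε₁ t ≡ 0 → ε₁ (insert one t) ≡ 0
    ε-one (tab u .zero zero    v q c) refl = refl
    ε-one (tab u .zero (suc h) v q c) refl = refl

  flip₂-recording : ∀ {w w′} → L₂.Flip w w′ → recording empty w ≡ recording empty w′
  flip₂-recording (L₂.flip-at u v p q)
    rewrite recording-++ empty u (suc j ∷ v) | recording-++ empty u (suc (suc j) ∷ v) | role-1+j | role-2+j =
    let t = tableau u
        ε≡0 = trans (ε₂-insertWord empty u) p
        l , same = create-lower₂ t ε≡0
    in cong (recording empty u ++_) (cong₂ _∷_ same (lower₂-recording v l
         (trans (cong (λ h → L₂.unmatched h v) (ε-two t ε≡0)) q)))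
    where
    ε-two : ∀ t → ε₂ t ≡ 0 → ε₂ (insert two t) ≡ 0
    ε-two (tab u g zero v q c) eq = m≤n⇒m∸n≡0 (m≤n⇒m≤1+n (m∸n≡0⇒m≤n {q} {g} eq))

  s₁-recording : ∀ w → recording empty (s-word j w) ≡ recording empty w
  s₁-recording = s-word-invariant j (recording empty) flip₁-recording

  s₂-recording : ∀ w → recording empty (s-word (suc j) w) ≡ recording empty w
  s₂-recording = s-word-invariant (suc j) (recording empty) flip₂-recording

  -- Equal recordings force equal shapes, and the other three equalities then single out the
  -- insertion tableau; insertion is undone from this tableau and the recording.
  word-determined : ∀ w w′ → recording empty w ≡ recording empty w′ → count j w ≡ count j w′ →
    count (suc j) w ≡ count (suc j) w′ → L₁.ε w ≡ L₁.ε w′ → w ≡ w′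
  word-determined w w′ rec n₁ n₂ e = proj₂ (insertion-injective empty w empty w′ rec
    (tab-determined (tableau w) (tableau w′)
      (rows row₁-length box₁ row₁-insert)
      (rows row₂-length box₂ row₂-insert)
      (rows row₃-length box₃ row₃-insert)
      (letters count-one count-one-insertWord n₁)
      (letters count-two count-two-insertWord n₂)
      (trans (ε₁-insertWord empty w) (trans e (sym (ε₁-insertWord empty w′))))))
    where
    rows : (m : Tab → ℕ) (b : Row → ℕ) → (∀ r t → m (insert r t) ≡ b (newBox r t) + m t) →
           m (tableau w) ≡ m (tableau w′)
    rows m b step = trans (insertWord-boxes m b step empty w)
      (trans (cong (λ r → sum (map b r) + m empty) rec) (sym (insertWord-boxes m b step empty w′)))
    letters : (m : Tab → ℕ) {k : ℕ} → (∀ t w → m (insertWord t w) ≡ count k w + m t) →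
              count k w ≡ count k w′ → m (tableau w) ≡ m (tableau w′)
    letters m cnt eq = trans (cnt empty w) (trans (cong (_+ m empty) eq) (sym (cnt empty w′)))

  -- The two counts are exchanged twice, and so are `φ` and `ε`; uniqueness does the rest.
  s₁-involutive : ∀ w → s-word j (s-word j w) ≡ w
  s₁-involutive w = word-determined _ w
    (trans (s₁-recording (s-word j w)) (s₁-recording w))
    (trans (count-i-s-word j (s-word j w)) (count-1+i-s-word j w))
    (trans (count-1+i-s-word j (s-word j w)) (count-i-s-word j w))
    (trans (ε-s-word j (s-word j w)) (φ-s-word j w))

  -- The braid relation

  private
    ε-shift₁ : ∀ w → L₁.ε (s-word j w) + count (suc j) w ≡ L₁.ε w + count j w
    ε-shift₁ w = trans (cong (_+ count (suc j) w) (ε-s-word j w))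
      (trans (+-comm (L₁.φ w) _) (trans (sym (L₁.count-excess w)) (+-comm (count j w) _)))

    second-row : Word → ℕ
    second-row w = row₂-length (tableau w)

    second-row-recording : ∀ {w w′} → recording empty w ≡ recording empty w′ → second-row w ≡ second-row w′
    second-row-recording {w} {w′} rec = trans (insertWord-boxes row₂-length box₂ row₂-insert empty w)
      (trans (cong (λ r → sum (map box₂ r) + 0) rec) (sym (insertWord-boxes row₂-length box₂ row₂-insert empty w′)))

    ε-sum-word : ∀ w → L₁.ε w + L₂.ε w + count j w + count (suc j) w ≡
                       row₁-length (tableau w) + (second-row w ⊔ count (suc j) w)
    ε-sum-word w = subst₂ _≡_
      (cong₂ _+_ (cong₂ _+_ (cong₂ _+_ (ε₁-insertWord empty w) (ε₂-insertWord empty w)) n₁) n₂)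
      (cong (λ z → row₁-length (tableau w) + (second-row w ⊔ z)) n₂)
      (ε-sum (tableau w))
      where
      n₁ = trans (count-one-insertWord empty w) (+-identityʳ _)
      n₂ = trans (count-two-insertWord empty w) (+-identityʳ _)

    -- The change of `L₂.ε` is known from the counts, and the change of the sum of both string
    -- lengths from `ε-sum`; the difference is the change of `L₁.ε`. The maxima come from the
    -- right-hand side of `ε-sum`, evaluated before and after the exchange of two counts.
    ε-shift₂ : ∀ w → L₁.ε (s-word (suc j) w) + (second-row w ⊔ count (suc j) w) ≡
                     L₁.ε w + (second-row w ⊔ count (suc (suc j)) w)
    ε-shift₂ w = arith (L₁.ε w) (L₁.ε w′) (L₂.ε w) (L₂.ε w′) (count j w) (count (suc j) w) (count (suc (suc j)) w)
      (row₁-length (tableau w)) (second-row w ⊔ count (suc j) w) (second-row w ⊔ count (suc (suc j)) w)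
      (ε-sum-word w)
      (subst₂ _≡_
        (cong₂ _+_ (cong (L₁.ε w′ + L₂.ε w′ +_) (count-other-s-word (suc j) (λ ()) (λ ()) w)) (count-i-s-word (suc j) w))
        (cong₂ _+_ a-same (cong₂ _⊔_ (second-row-recording (s₂-recording w)) (count-i-s-word (suc j) w)))
        (ε-sum-word w′))
      (trans (L₂.count-excess w) (cong (count (suc (suc j)) w +_) (sym (ε-s-word (suc j) w))))
      where
      w′ = s-word (suc j) w
      a-same = trans (insertWord-boxes row₁-length box₁ row₁-insert empty w′)
        (trans (cong (λ r → sum (map box₁ r) + 0) (s₂-recording w)) (sym (insertWord-boxes row₁-length box₁ row₁-insert empty w)))
      arith : ∀ x x′ y y′ n₁ n₂ n₃ a m₂ m₃ → x + y + n₁ + n₂ ≡ a + m₂ → x′ + y′ + n₁ + n₃ ≡ a + m₃ →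
              n₂ + y ≡ n₃ + y′ → x′ + m₂ ≡ x + m₃
      arith x x′ y y′ n₁ n₂ n₃ a m₂ m₃ e₁ e₂ e₃ = +-cancelʳ-≡ (a + (n₃ + y′) + n₁) _ _ (begin
        x′ + m₂ + (a + (n₃ + y′) + n₁)           ≡⟨ lem₁ x′ m₂ a n₃ y′ n₁ ⟩
        (x′ + y′ + n₁ + n₃) + (a + m₂)           ≡⟨ cong₂ _+_ e₂ (sym e₁) ⟩
        (a + m₃) + (x + y + n₁ + n₂)             ≡⟨ lem₂ a m₃ x y n₁ n₂ ⟩
        x + m₃ + (a + (n₂ + y) + n₁)             ≡⟨ cong (λ z → x + m₃ + (a + z + n₁)) e₃ ⟩
        x + m₃ + (a + (n₃ + y′) + n₁)            ∎)
        where
        open ≡-Reasoning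
        lem₁ : ∀ x′ m₂ a n₃ y′ n₁ → x′ + m₂ + (a + (n₃ + y′) + n₁) ≡ (x′ + y′ + n₁ + n₃) + (a + m₂)
        lem₁ = solve-∀
        lem₂ : ∀ a m₃ x y n₁ n₂ → (a + m₃) + (x + y + n₁ + n₂) ≡ x + m₃ + (a + (n₂ + y) + n₁)
        lem₂ = solve-∀

  braid : ∀ w → s-word j (s-word (suc j) (s-word j w)) ≡ s-word (suc j) (s-word j (s-word (suc j) w))
  braid w = word-determined w₃ v₃ rec n₁-same n₂-same ε-same
    where
    S₁ = s-word j
    S₂ = s-word (suc j)
    w₁ = S₁ w
    w₂ = S₂ w₁
    w₃ = S₁ w₂
    v₁ = S₂ w
    v₂ = S₁ v₁
    v₃ = S₂ v₂
    b  = second-row w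
    n₁ = count j w
    n₂ = count (suc j) w
    n₃ = count (suc (suc j)) w
    rec : recording empty w₃ ≡ recording empty v₃
    rec = trans (trans (s₁-recording w₂) (trans (s₂-recording w₁) (s₁-recording w)))
      (sym (trans (s₂-recording v₂) (trans (s₁-recording v₁) (s₂-recording w))))
    fixes₁ : ∀ z → count (suc (suc j)) (S₁ z) ≡ count (suc (suc j)) z
    fixes₁ = count-other-s-word j (λ ()) (λ ())
    fixes₂ : ∀ z → count j (S₂ z) ≡ count j z
    fixes₂ = count-other-s-word (suc j) (λ ()) (λ ())
    w₁-n₁ : count j w₁ ≡ n₂
    w₁-n₁ = count-i-s-word j w
    w₁-n₂ : count (suc j) w₁ ≡ n₁
    w₁-n₂ = count-1+i-s-word j w
    w₁-n₃ : count (suc (suc j)) w₁ ≡ n₃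
    w₁-n₃ = fixes₁ w
    w₂-n₁ : count j w₂ ≡ n₂
    w₂-n₁ = trans (fixes₂ w₁) w₁-n₁
    w₂-n₂ : count (suc j) w₂ ≡ n₃
    w₂-n₂ = trans (count-i-s-word (suc j) w₁) w₁-n₃
    v₁-n₁ : count j v₁ ≡ n₁
    v₁-n₁ = fixes₂ w
    v₁-n₂ : count (suc j) v₁ ≡ n₃
    v₁-n₂ = count-i-s-word (suc j) w
    v₁-n₃ : count (suc (suc j)) v₁ ≡ n₂
    v₁-n₃ = count-1+i-s-word (suc j) w
    v₂-n₁ : count j v₂ ≡ n₃
    v₂-n₁ = trans (count-i-s-word j v₁) v₁-n₂
    v₂-n₂ : count (suc j) v₂ ≡ n₁
    v₂-n₂ = trans (count-1+i-s-word j v₁) v₁-n₁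
    v₂-n₃ : count (suc (suc j)) v₂ ≡ n₂
    v₂-n₃ = trans (fixes₁ v₁) v₁-n₃
    n₁-same : count j w₃ ≡ count j v₃
    n₁-same = trans (trans (count-i-s-word j w₂) w₂-n₂) (sym (trans (fixes₂ v₂) v₂-n₁))
    n₂-same : count (suc j) w₃ ≡ count (suc j) v₃
    n₂-same = trans (trans (count-1+i-s-word j w₂) w₂-n₁) (sym (trans (count-i-s-word (suc j) v₂) v₂-n₃))
    b-w₁ : second-row w₁ ≡ b
    b-w₁ = second-row-recording (s₁-recording w)
    b-v₂ : second-row v₂ ≡ b
    b-v₂ = trans (second-row-recording (s₁-recording v₁)) (second-row-recording (s₂-recording w))
    -- Both x₃ and y₃ come out as x + n₁ - n₃ + m₃ - m₁: on one side the contributions of n₂ cancel,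
    -- on the other those of m₂.
    arith : ∀ x x₁ x₂ x₃ y₁ y₂ y₃ n₁ n₂ n₃ m₁ m₂ m₃ →
      x₁ + n₂ ≡ x + n₁ → x₂ + m₁ ≡ x₁ + m₃ → x₃ + n₃ ≡ x₂ + n₂ →
      y₁ + m₂ ≡ x + m₃ → y₂ + n₃ ≡ y₁ + n₁ → y₃ + m₁ ≡ y₂ + m₂ → x₃ ≡ y₃
    arith x x₁ x₂ x₃ y₁ y₂ y₃ n₁ n₂ n₃ m₁ m₂ m₃ e₁ e₂ e₃ d₁ d₂ d₃ = +-cancelʳ-≡ (m₁ + n₃) _ _ (begin
      x₃ + (m₁ + n₃) ≡⟨ lem₁ x₃ m₁ n₃ ⟩
      x₃ + n₃ + m₁   ≡⟨ cong (_+ m₁) e₃ ⟩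
      x₂ + n₂ + m₁   ≡⟨ lem₂ x₂ n₂ m₁ ⟩
      x₂ + m₁ + n₂   ≡⟨ cong (_+ n₂) e₂ ⟩
      x₁ + m₃ + n₂   ≡⟨ lem₂ x₁ m₃ n₂ ⟩
      x₁ + n₂ + m₃   ≡⟨ cong (_+ m₃) e₁ ⟩
      x + n₁ + m₃    ≡⟨ lem₂ x n₁ m₃ ⟩
      x + m₃ + n₁    ≡⟨ cong (_+ n₁) d₁ ⟨
      y₁ + m₂ + n₁   ≡⟨ lem₂ y₁ m₂ n₁ ⟩
      y₁ + n₁ + m₂   ≡⟨ cong (_+ m₂) d₂ ⟨
      y₂ + n₃ + m₂   ≡⟨ lem₂ y₂ n₃ m₂ ⟩
      y₂ + m₂ + n₃   ≡⟨ cong (_+ n₃) d₃ ⟨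
      y₃ + m₁ + n₃   ≡⟨ +-assoc y₃ m₁ n₃ ⟩
      y₃ + (m₁ + n₃) ∎)
      where
      open ≡-Reasoning
      lem₁ : ∀ a b c → a + (b + c) ≡ a + c + b
      lem₁ = solve-∀
      lem₂ : ∀ a b c → a + b + c ≡ a + c + b
      lem₂ = solve-∀
    shift₁ : ∀ z {p q} → count (suc j) z ≡ p → count j z ≡ q → L₁.ε (S₁ z) + p ≡ L₁.ε z + q
    shift₁ z refl refl = ε-shift₁ z
    shift₂ : ∀ z {r p q} → second-row z ≡ r → count (suc j) z ≡ p → count (suc (suc j)) z ≡ q →
             L₁.ε (S₂ z) + (r ⊔ p) ≡ L₁.ε z + (r ⊔ q)
    shift₂ z refl refl refl = ε-shift₂ z
    ε-same : L₁.ε w₃ ≡ L₁.ε v₃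
    ε-same = arith (L₁.ε w) (L₁.ε w₁) (L₁.ε w₂) (L₁.ε w₃) (L₁.ε v₁) (L₁.ε v₂) (L₁.ε v₃)
      n₁ n₂ n₃ (b ⊔ n₁) (b ⊔ n₂) (b ⊔ n₃)
      (shift₁ w refl refl) (shift₂ w₁ b-w₁ w₁-n₂ w₁-n₃) (shift₁ w₂ w₂-n₂ w₂-n₁)
      (shift₂ w refl refl refl) (shift₁ v₁ v₁-n₂ v₁-n₁) (shift₂ v₂ b-v₂ v₂-n₂ v₂-n₃)

-- Distant reflections and the Coxeter element

module _ (o c : ℕ) (R : ℕ → ℕ → Set) (R-o : R o o)
         (R-kind : ∀ {x y} → R x y → Brackets.kind o c x ≡ Brackets.kind o c y) where
  open Brackets o c

  hasUnmatched-cong : ∀ h {u v} → Pointwise R u v → hasUnmatchedClosing h u ≡ hasUnmatchedClosing h v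
  hasUnmatched-cong h [] = refl
  hasUnmatched-cong h {x ∷ _} {y ∷ _} (r ∷ rs) with kind x | kind y | R-kind r | h
  ... | opening | .opening | refl | h     = hasUnmatched-cong (suc h) rs
  ... | closing | .closing | refl | zero  = refl
  ... | closing | .closing | refl | suc h = hasUnmatched-cong h rs
  ... | neutral | .neutral | refl | h     = hasUnmatched-cong h rs

  flipLast-cong : ∀ h {u v} → Pointwise R u v → Pointwise R (flipLast h u) (flipLast h v)
  flipLast-cong h [] = []
  flipLast-cong h {x ∷ u} {y ∷ v} (r ∷ rs) with kind x | kind y | R-kind r | h
  ... | opening | .opening | refl | h     = r ∷ flipLast-cong (suc h) rs
  ... | closing | .closing | refl | suc h = r ∷ flipLast-cong h rs
  ... | neutral | .neutral | refl | h     = r ∷ flipLast-cong h rs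
  ... | closing | .closing | refl | zero with hasUnmatchedClosing 0 u | hasUnmatchedClosing 0 v | hasUnmatched-cong 0 rs
  ...   | true  | .true  | refl = r ∷ flipLast-cong 0 rs
  ...   | false | .false | refl = R-o ∷ rs

Agree : (ℕ → Set) → ℕ → ℕ → Set
Agree P x y = x ≡ y ⊎ (P x × P y)

agree-sym : ∀ {P x y} → Agree P x y → Agree P y x
agree-sym (inj₁ eq)      = inj₁ (sym eq)
agree-sym (inj₂ (p , q)) = inj₂ (q , p)

agree-trans : ∀ {P x y z} → Agree P x y → Agree P y z → Agree P x z
agree-trans (inj₁ refl)    a              = a
agree-trans (inj₂ (p , q)) (inj₁ refl)    = inj₂ (p , q)
agree-trans (inj₂ (p , _)) (inj₂ (_ , r)) = inj₂ (p , r)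

Agreeing : (ℕ → Set) → Word → Word → Set
Agreeing P = Pointwise (Agree P)

agreeing-refl : ∀ {P w} → Agreeing P w w
agreeing-refl = Pointwise.refl (inj₁ refl)

agreeing-sym : ∀ {P u v} → Agreeing P u v → Agreeing P v u
agreeing-sym = Pointwise.symmetric agree-sym

agreeing-trans : ∀ {P u v w} → Agreeing P u v → Agreeing P v w → Agreeing P u w
agreeing-trans = Pointwise.transitive agree-trans

Avoids : ℕ → ℕ → Set
Avoids i x = x ≢ i × x ≢ suc i

s-word-agrees : ∀ {P} i → P i → P (suc i) → ∀ w → Agreeing P w (s-word i w)
s-word-agrees {P} i p p′ =
  s-word-preserves i (Agreeing P) agreeing-refl agreeing-trans fwd (agreeing-sym ∘ fwd)
  where
  open Letter i
  fwd : ∀ {w w′} → Flip w w′ → Agreeing P w w′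
  fwd (flip-at []      v _ _) = inj₂ (p , p′) ∷ agreeing-refl
  fwd (flip-at (x ∷ u) v _ _) = inj₁ refl ∷ go u
    where
    go : ∀ u → Agreeing P (u ++ i ∷ v) (u ++ suc i ∷ v)
    go []      = inj₂ (p , p′) ∷ agreeing-refl
    go (x ∷ u) = inj₁ refl ∷ go u

module _ (i : ℕ) where
  private
    kind-agree : ∀ {x y} → Agree (Avoids i) x y → Brackets.kind (suc i) i x ≡ Brackets.kind (suc i) i y
    kind-agree (inj₁ refl) = refl
    kind-agree {x} {y} (inj₂ ((a , b) , (a′ , b′))) =
      trans (BracketStatistics.kind-neutral (suc i) i x b a) (sym (BracketStatistics.kind-neutral (suc i) i y b′ a′))

    kind-agree′ : ∀ {x y} → Agree (Avoids i) x y → Brackets.kind i (suc i) x ≡ Brackets.kind i (suc i) y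
    kind-agree′ (inj₁ refl) = refl
    kind-agree′ {x} {y} (inj₂ ((a , b) , (a′ , b′))) =
      trans (BracketStatistics.kind-neutral i (suc i) x a b) (sym (BracketStatistics.kind-neutral i (suc i) y a′ b′))

    iterate : ∀ (f : Word → Word) → (∀ {u v} → Agreeing (Avoids i) u v → Agreeing (Avoids i) (f u) (f v)) →
              ∀ k {u v} → Agreeing (Avoids i) u v → Agreeing (Avoids i) ((f ^^ k) u) ((f ^^ k) v)
    iterate f resp zero    a = a
    iterate f resp (suc k) a = resp (iterate f resp k a)

  f-word-cong : ∀ {u v} → Agreeing (Avoids i) u v → Agreeing (Avoids i) (f-word i u) (f-word i v)
  f-word-cong = flipLast-cong (suc i) i (Agree (Avoids i)) (inj₁ refl) kind-agree 0

  e-word-cong : ∀ {u v} → Agreeing (Avoids i) u v → Agreeing (Avoids i) (e-word i u) (e-word i v)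
  e-word-cong a = Pointwise.reverse⁺
    (flipLast-cong i (suc i) (Agree (Avoids i)) (inj₁ refl) kind-agree′ 0 (Pointwise.reverse⁺ a))

  count-cong : ∀ k → (∀ {x} → Avoids i x → x ≢ k) → ∀ {u v} → Agreeing (Avoids i) u v → count k u ≡ count k v
  count-cong k avoids [] = refl
  count-cong k avoids {x ∷ u} {y ∷ v} (inj₁ refl ∷ a) with x ≟ k
  ... | yes refl = trans (count-here x u) (trans (cong suc (count-cong k avoids a)) (sym (count-here x v)))
  ... | no x≢k   = trans (count-there u x≢k) (trans (count-cong k avoids a) (sym (count-there v x≢k)))
  count-cong k avoids {x ∷ u} {y ∷ v} (inj₂ (p , q) ∷ a) =
    trans (count-there u (avoids p)) (trans (count-cong k avoids a) (sym (count-there v (avoids q))))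

  -- The reflection depends only on the kinds of the letters as brackets and on two counts, neither
  -- of which sees a letter that avoids `i` and `suc i`.
  s-word-cong : ∀ {u v} → Agreeing (Avoids i) u v → Agreeing (Avoids i) (s-word i u) (s-word i v)
  s-word-cong {u} {v} a
    rewrite count-cong i proj₁ a | count-cong (suc i) proj₂ a
    with count (suc i) v ≤ᵇ count i v
  ... | true  = iterate (f-word i) f-word-cong (count i v ∸ count (suc i) v) a
  ... | false = iterate (e-word i) e-word-cong (count (suc i) v ∸ count i v) a

agreeing⇒≡ : ∀ {P Q u v} → Agreeing P u v → Agreeing Q u v → Agreeing (λ x → ¬ (P x × Q x)) u v → u ≡ v
agreeing⇒≡ [] [] [] = refl
agreeing⇒≡ (p ∷ ps) (q ∷ qs) (r ∷ rs) = cong₂ _∷_ (head p q r) (agreeing⇒≡ ps qs rs)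
  where
  head : ∀ {P Q x y} → Agree P x y → Agree Q x y → Agree (λ x → ¬ (P x × Q x)) x y → x ≡ y
  head (inj₁ eq)      _              _              = eq
  head (inj₂ _)       (inj₁ eq)      _              = eq
  head (inj₂ _)       (inj₂ _)       (inj₁ eq)      = eq
  head (inj₂ (p , _)) (inj₂ (q , _)) (inj₂ (n , _)) = ⊥-elim (n (p , q))

-- Up to letters avoiding `i` and `suc i`, both composites agree with `s-word i w`; up to letters
-- avoiding `j` and `suc j`, with `s-word j w`; and only these four letters are ever changed. A
-- position of disagreement would hold a letter that avoids all four and is one of them.
s-word-commute : ∀ i j → suc i < j → ∀ w → s-word i (s-word j w) ≡ s-word j (s-word i w)
s-word-commute i j i+1<j w = agreeing⇒≡ {Avoids i} {Avoids j}
  (agreeing-trans (s-word-cong i (agreeing-sym (s-word-agrees j j-i 1+j-i w))) (s-word-agrees j j-i 1+j-i (s-word i w)))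
  (agreeing-trans (agreeing-sym (s-word-agrees i i-j 1+i-j (s-word j w))) (s-word-cong j (s-word-agrees i i-j 1+i-j w)))
  (agreeing-trans (agreeing-sym (agreeing-trans (moved j inside-j inside-j′ w) (moved i inside-i inside-i′ (s-word j w))))
    (agreeing-trans (moved i inside-i inside-i′ w) (moved j inside-j inside-j′ (s-word i w))))
  where
  Inside : ℕ → Set
  Inside x = ¬ (Avoids i x × Avoids j x)
  moved : ∀ k → Inside k → Inside (suc k) → ∀ w → Agreeing Inside w (s-word k w)
  moved k = s-word-agrees {Inside} k
  inside-i : Inside i
  inside-i ((p , _) , _) = p refl
  inside-i′ : Inside (suc i)
  inside-i′ ((_ , p) , _) = p refl
  inside-j : Inside j
  inside-j (_ , (p , _)) = p refl
  inside-j′ : Inside (suc j)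
  inside-j′ (_ , (_ , p)) = p refl
  i<j = <-trans (n<1+n i) i+1<j
  j-i : Avoids i j
  j-i = >⇒≢ i<j , >⇒≢ i+1<j
  1+j-i : Avoids i (suc j)
  1+j-i = >⇒≢ (m<n⇒m<1+n i<j) , >⇒≢ (m<n⇒m<1+n i+1<j)
  i-j : Avoids j i
  i-j = <⇒≢ i<j , <⇒≢ (m<n⇒m<1+n i<j)
  1+i-j : Avoids j (suc i)
  1+i-j = <⇒≢ i+1<j , <⇒≢ (m<n⇒m<1+n i+1<j)

^^-suc : ∀ {a} {A : Set a} (f : A → A) k x → (f ^^ suc k) x ≡ (f ^^ k) (f x)
^^-suc f zero    x = refl
^^-suc f (suc k) x = cong f (^^-suc f k x)

-- The order of the Coxeter element from the Coxeter relations

module CoxeterElement {A : Set} (σ : ℕ → A → A)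
  (involutive : ∀ i x → σ i (σ i x) ≡ x)
  (braided    : ∀ i x → σ i (σ (suc i) (σ i x)) ≡ σ (suc i) (σ i (σ (suc i) x)))
  (commute    : ∀ i j → suc i < j → ∀ x → σ i (σ j x) ≡ σ j (σ i x))
  where
  open ≡-Reasoning

  C : ℕ → A → A
  C zero    x = x
  C (suc m) x = C m (σ (suc m) x)

  C-commute : ∀ m j → suc m < j → ∀ x → C m (σ j x) ≡ σ j (C m x)
  C-commute zero    j lt x = refl
  C-commute (suc m) j lt x = begin
    C m (σ (suc m) (σ j x)) ≡⟨ cong (C m) (commute (suc m) j lt x) ⟩
    C m (σ j (σ (suc m) x)) ≡⟨ C-commute m j (<-trans (n<1+n _) lt) _ ⟩
    σ j (C m (σ (suc m) x)) ∎

  -- Conjugation by the Coxeter element advances a generator by one. Factors of high index commute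
  -- past it; the braid relation enters when the last factor is its neighbour.
  C-shift : ∀ m i → suc i < m → ∀ x → C m (σ (suc i) x) ≡ σ (suc (suc i)) (C m x)
  C-shift (suc m) i (s≤s i<m) x with m≤n⇒m<n∨m≡n i<m
  ... | inj₁ lt = begin
    C m (σ (suc m) (σ (suc i) x))       ≡⟨ cong (C m) (commute (suc i) (suc m) (s≤s lt) x) ⟨
    C m (σ (suc i) (σ (suc m) x))       ≡⟨ C-shift m i lt _ ⟩
    σ (suc (suc i)) (C m (σ (suc m) x)) ∎
  ... | inj₂ refl = begin
    C i (σ (suc i) (σ (suc (suc i)) (σ (suc i) x)))       ≡⟨ cong (C i) (braided (suc i) x) ⟩
    C i (σ (suc (suc i)) (σ (suc i) (σ (suc (suc i)) x))) ≡⟨ C-commute i _ ≤-refl _ ⟩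
    σ (suc (suc i)) (C i (σ (suc i) (σ (suc (suc i)) x))) ∎

  -- descent t k = σ t ∘ σ (t - 1) ∘ ⋯, with k factors (k ≤ t)
  descent : ℕ → ℕ → A → A
  descent (suc t) (suc k) x = σ (suc t) (descent t k x)
  descent _       _       x = x

  descent-shift : ∀ m t k → k ≤ t → t < m → ∀ x → descent (suc t) k (C m x) ≡ C m (descent t k x)
  descent-shift m zero    zero    _         _   x = refl
  descent-shift m (suc t) zero    _         _   x = refl
  descent-shift m (suc t) (suc k) (s≤s k≤t) t<m x = begin
    σ (suc (suc t)) (descent (suc t) k (C m x)) ≡⟨ cong (σ _) (descent-shift m t k k≤t (<⇒≤ t<m) x) ⟩
    σ (suc (suc t)) (C m (descent t k x))       ≡⟨ C-shift m t t<m _ ⟨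
    C m (σ (suc t) (descent t k x))             ∎

  -- Compares with the Coxeter element of one generator less. The top generators are pushed to the
  -- right through the copies of `C (suc m)`; each passage lowers their index by one, so they
  -- accumulate to a descending product.
  C-power : ∀ m k → k ≤ suc m → ∀ x → (C (suc m) ^^ k) x ≡ (C m ^^ k) (descent (suc m) k x)
  C-power m zero    _         x = refl
  C-power m (suc k) (s≤s k≤m) x = begin
    (C (suc m) ^^ suc k) x                        ≡⟨ ^^-suc (C (suc m)) k x ⟩
    (C (suc m) ^^ k) (C (suc m) x)                ≡⟨ C-power m k (m≤n⇒m≤1+n k≤m) _ ⟩
    (C m ^^ k) (descent (suc m) k (C (suc m) x))  ≡⟨ cong (C m ^^ k) (descent-shift (suc m) m k k≤m ≤-refl x) ⟩
    (C m ^^ k) (C m (σ (suc m) (descent m k x)))  ≡⟨ ^^-suc (C m) k _ ⟨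
    (C m ^^ suc k) (descent (suc m) (suc k) x)    ∎

  C-descent : ∀ m x → C m (descent m m x) ≡ x
  C-descent zero    x = refl
  C-descent (suc m) x = trans (cong (C m) (involutive (suc m) _)) (C-descent m x)

  -- At exponent `suc m` the smaller Coxeter element disappears by induction, and what is left of
  -- the power is the full descending product, the inverse of `C (suc m)`; one more factor cancels
  -- it.
  C-order : ∀ m x → (C m ^^ suc m) x ≡ x
  C-order zero    x = refl
  C-order (suc m) x = begin
    C (suc m) ((C (suc m) ^^ suc m) x)                        ≡⟨ cong (C (suc m)) (C-power m (suc m) ≤-refl x) ⟩
    C (suc m) ((C m ^^ suc m) (descent (suc m) (suc m) x))    ≡⟨ cong (C (suc m)) (C-order m _) ⟩
    C (suc m) (descent (suc m) (suc m) x)                     ≡⟨ C-descent (suc m) x ⟩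
    x                                                         ∎

open CoxeterElement s-word (λ i → Insertion.s₁-involutive i) (λ i → Insertion.braid i) s-word-commute public
  renaming (C to coxeter-word; C-order to coxeter-word-order)

-- Semistandardness

Sorted : Word → Set
Sorted = AllPairs _≤_

count-absent : ∀ {k w} → All (k <_) w → count k w ≡ 0
count-absent {k} all = cong length (filter-none (_≟ k) (All.map >⇒≢ all))

atMost : ℕ → Word → ℕ
atMost k w = length (filter (_≤? k) w)

atMost-++ : ∀ k u v → atMost k (u ++ v) ≡ atMost k u + atMost k v
atMost-++ k u v = trans (cong length (filter-++ (_≤? k) u v)) (length-++ (filter (_≤? k) u))

atMost-in : ∀ {k x} w → x ≤ k → atMost k (x ∷ w) ≡ suc (atMost k w)
atMost-in w x≤k = cong length (filter-accept (_≤? _) x≤k)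

atMost-out : ∀ {k x} w → k < x → atMost k (x ∷ w) ≡ atMost k w
atMost-out w k<x = cong length (filter-reject (_≤? _) (<⇒≱ k<x))

atMost-none : ∀ {k w} → All (k <_) w → atMost k w ≡ 0
atMost-none {k} all = cong length (filter-none (_≤? k) (All.map <⇒≱ all))

atMost-suc : ∀ k w → atMost (suc k) w ≡ atMost k w + count (suc k) w
atMost-suc k [] = refl
atMost-suc k (x ∷ w) with <-cmp x (suc k)
... | tri< (s≤s x≤k) x≢k _
  rewrite atMost-in w (m≤n⇒m≤1+n x≤k) | atMost-in w x≤k | count-there w x≢k = cong suc (atMost-suc k w)
... | tri≈ _ refl _
  rewrite atMost-in {suc k} w ≤-refl | atMost-out {k} w ≤-refl | count-here (suc k) w =
    trans (cong suc (atMost-suc k w)) (sym (+-suc _ _))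
... | tri> _ x≢k k<x
  rewrite atMost-out w k<x | atMost-out w (<-trans (n<1+n k) k<x) | count-there w x≢k = atMost-suc k w

-- Column strictness between two rows, in a form that only depends on their contents.
StrictBelow : Word → Word → Set
StrictBelow lower upper = ∀ k → atMost (suc k) lower ≤ atMost k upper

above⇒strict : ∀ {u l} → Above u l → StrictBelow l u
above⇒strict [] k = z≤n
above⇒strict {y ∷ u} {x ∷ l} (x>y ∷ p) k with x ≤? suc k
... | yes x≤1+k = subst₂ _≤_ (sym (atMost-in l x≤1+k)) (sym (atMost-in u (s≤s⁻¹ (≤-trans x>y x≤1+k)))) (s≤s (above⇒strict p k))
... | no x≰1+k = ≤-trans (≤-reflexive (atMost-out l (≰⇒> x≰1+k))) (≤-trans (above⇒strict p k)
                   (subst (atMost k u ≤_) (sym (atMost-++ k [ y ] u)) (m≤n+m _ _)))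

-- The thresholds for the lower row start at 1, so 0 and 1 cannot be told apart there; positivity of
-- `l` excludes a 0 below a 0.
strict⇒above : ∀ {u l} → Sorted u → Sorted l → All (1 ≤_) l → StrictBelow l u → Above u l
strict⇒above {l = []} _ _ _ _ = []
strict⇒above {[]} {zero ∷ l} _ _ (() ∷ _) _
strict⇒above {[]} {suc x ∷ l} _ _ _ col with () ← ≤-trans (≤-reflexive (sym (atMost-in {suc x} l ≤-refl))) (col x)
strict⇒above {y ∷ u} {suc x ∷ l} (y≤ ∷ su) (x≤ ∷ sl) (_ ∷ pos) col = x>y ∷ strict⇒above su sl pos tail
  where
  x>y : y < suc x
  x>y with y <? suc x
  ... | yes p = p
  ... | no p = ⊥-elim (<-irrefl refl (≤-trans (≤-trans z<s (≤-reflexive (sym (atMost-in {suc x} l ≤-refl))))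
          (≤-trans (col x) (≤-reflexive (atMost-none (≰⇒> (p ∘ s≤s) ∷ All.map (≤-trans (≰⇒> (p ∘ s≤s))) y≤))))))
  tail : StrictBelow l u
  tail k with suc x ≤? suc k
  ... | yes x≤k = s≤s⁻¹ (subst₂ _≤_ (atMost-in l x≤k) (atMost-in u (s≤s⁻¹ (≤-trans x>y x≤k))) (col k))
  ... | no x≰k = ≤-trans (≤-reflexive (atMost-none (All.map (≤-trans (≰⇒> x≰k)) x≤))) z≤n

replace-linked : ∀ {a} {A : Set a} {R : A → A → Set} {r r′ : A} as {bs} →
  (∀ as′ a → as ≡ as′ ∷ʳ a → R a r → R a r′) → (∀ b bs′ → bs ≡ b ∷ bs′ → R r b → R r′ b) →
  Linked R (as ++ r ∷ bs) → Linked R (as ++ r′ ∷ bs)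
replace-linked []            {[]}     f g l       = [-]
replace-linked []            {b ∷ bs} f g (x ∷ l) = g b bs refl x ∷ l
replace-linked (a ∷ [])      f g (x ∷ l)          = f [] a refl x ∷ replace-linked [] (λ { [] _ () ; (_ ∷ _) _ () }) g l
replace-linked (a ∷ a′ ∷ as) f g (x ∷ l)          =
  x ∷ replace-linked (a′ ∷ as) (λ as′ b eq → f (a ∷ as′) b (cong (a ∷_) eq)) g l

locate : ∀ (r : Word) rs u {x v} → concat (r ∷ rs) ≡ u ++ x ∷ v → ∃[ A ] ∃[ p ] ∃[ q ] ∃[ B ]
  (r ∷ rs ≡ A ++ (p ++ x ∷ q) ∷ B × u ≡ concat A ++ p × v ≡ q ++ concat B)
locate [] []       []      ()
locate [] []       (_ ∷ _) ()
locate [] (r ∷ rs) u eq with locate r rs u eq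
... | A , p , q , B , e₁ , e₂ , e₃ = [] ∷ A , p , q , B , cong ([] ∷_) e₁ , e₂ , e₃
locate (y ∷ r) rs [] refl = [] , [] , r , rs , refl , refl , refl
locate (y ∷ r) rs (z ∷ u) eq with refl , eq′ ← ∷-injective eq with locate r rs u eq′
... | []     , p , q , B , refl , e₂ , e₃ = [] , y ∷ p , q , B , refl , cong (y ∷_) e₂ , e₃
... | _ ∷ A  , p , q , B , refl , e₂ , e₃ = (y ∷ r) ∷ A , p , q , B , refl , cong (y ∷_) e₂ , e₃

-- Flips preserve semistandardness

Bounded : ℕ → Word → Set
Bounded n = All (λ e → 1 ≤ e × e ≤ n)

-- The rows are in reading order, bottom row first, which turns the column condition around.
Good : ℕ → List Word → Set
Good n rows = All (Linked _≤_) rows × All (Bounded n) rows × Linked (λ l u → Above u l) rows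

-- Quantifying over all divisions into rows makes this a preorder on words, the form that
-- `s-word-preserves` asks for.
Transfers : ℕ → Word → Word → Set
Transfers n w w′ = ∀ rows → concat rows ≡ w → Good n rows →
  ∃[ rows′ ] (map length rows′ ≡ map length rows × concat rows′ ≡ w′ × Good n rows′)

transfers-refl : ∀ {n w} → Transfers n w w
transfers-refl rows eq good = rows , refl , eq , good

transfers-trans : ∀ {n u v w} → Transfers n u v → Transfers n v w → Transfers n u w
transfers-trans t t′ rows eq good =
  let rows₁ , shape₁ , eq₁ , good₁ = t rows eq good
      rows₂ , shape₂ , eq₂ , good₂ = t′ rows₁ eq₁ good₁
  in rows₂ , trans shape₂ shape₁ , eq₂ , good₂

module _ (i : ℕ) where
  open Letter i

  unmatched≤count : ∀ h w → unmatched h w ≤ count i w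
  unmatched≤count h [] = z≤n
  unmatched≤count h (x ∷ w) with kind x in eq
  ... | opening with refl ← kind-opening x eq = ≤-trans (unmatched≤count (suc h) w) (≤-reflexive (sym (count-there w 1+i≢i)))
  ... | neutral = ≤-trans (unmatched≤count h w) (≤-trans (m≤n+m _ _) (≤-reflexive (sym (count-++ i [ x ] w))))
  ... | closing with refl ← kind-closing x eq with h
  ...   | zero  = ≤-trans (s≤s (unmatched≤count 0 w)) (≤-reflexive (sym (count-here i w)))
  ...   | suc h = ≤-trans (m≤n⇒m≤1+n (unmatched≤count h w)) (≤-reflexive (sym (count-here i w)))

  pending≤ : ∀ w → pending 0 w ≤ count (suc i) w
  pending≤ w = +-cancelˡ-≤ (count i w) _ _ (begin
    count i w + pending 0 w         ≡⟨ count-excess w ⟩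
    count (suc i) w + unmatched 0 w ≤⟨ +-monoʳ-≤ (count (suc i) w) (unmatched≤count 0 w) ⟩
    count (suc i) w + count i w     ≡⟨ +-comm (count (suc i) w) _ ⟩
    count i w + count (suc i) w     ∎)
    where open ≤-Reasoning

  pending-≥ : ∀ h w → h ≤ count i w + pending h w
  pending-≥ h w = subst (h ≤_) (sym (count-brackets h w)) (m≤n+m h _)

  -- In a sorted row each `i` stands before each `suc i`, so no pair is matched inside the row. The
  -- same fact underlies `sorted-unmatched`.
  sorted-pending : ∀ {w} → Sorted w → count (suc i) w ≤ pending 0 w
  sorted-pending {[]} [] = z≤n
  sorted-pending {x ∷ w} (x≤ ∷ sw) with <-cmp x i
  ... | tri< x<i x≢i _ rewrite kind-neutral x (<⇒≢ (m<n⇒m<1+n x<i)) x≢i | count-there w (<⇒≢ (m<n⇒m<1+n x<i)) = sorted-pending sw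
  ... | tri≈ _ refl _ rewrite kind-c i≢1+i | count-there w i≢1+i = sorted-pending sw
  ... | tri> _ _ i<x = ≤-trans (m≤m+n _ _) (≤-reflexive (sym
          (subst (λ z → z + ε (x ∷ w) ≡ count (suc i) (x ∷ w) + φ (x ∷ w))
            (count-absent (i<x ∷ All.map (≤-trans i<x) x≤)) (count-excess (x ∷ w)))))

  sorted-unmatched : ∀ h {w} → Sorted w → count i w ≤ unmatched h w + h
  sorted-unmatched h {[]} [] = z≤n
  sorted-unmatched h {x ∷ w} (x≤ ∷ sw) with <-cmp x i
  ... | tri< x<i x≢i _ rewrite kind-neutral x (<⇒≢ (m<n⇒m<1+n x<i)) x≢i | count-there w x≢i = sorted-unmatched h sw
  ... | tri> _ _ i<x = ≤-trans (≤-reflexive (count-absent (i<x ∷ All.map (≤-trans i<x) x≤))) z≤n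
  ... | tri≈ _ refl _ rewrite kind-c i≢1+i | count-here i w with h
  ...   | zero  = s≤s (sorted-unmatched 0 sw)
  ...   | suc h = ≤-trans (s≤s (sorted-unmatched h sw)) (≤-reflexive (sym (+-suc _ h)))

  atMost-change : ∀ k p q → k ≢ i → atMost k (p ++ i ∷ q) ≡ atMost k (p ++ suc i ∷ q)
  atMost-change k p q k≢i rewrite atMost-++ k p (i ∷ q) | atMost-++ k p (suc i ∷ q) with <-cmp k i
  ... | tri< k<i _ _ rewrite atMost-out q k<i | atMost-out q (m<n⇒m<1+n k<i) = refl
  ... | tri≈ _ k≡i _ = ⊥-elim (k≢i k≡i)
  ... | tri> _ _ i<k rewrite atMost-in q (<⇒≤ i<k) | atMost-in q i<k = refl

  atMost-change-i : ∀ p q → atMost i (p ++ i ∷ q) ≡ suc (atMost i (p ++ suc i ∷ q))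
  atMost-change-i p q rewrite atMost-++ i p (i ∷ q) | atMost-++ i p (suc i ∷ q)
    | atMost-in {i} q ≤-refl | atMost-out {i} q ≤-refl = +-suc _ _

  atMost-raise : ∀ k p q → atMost k (p ++ suc i ∷ q) ≤ atMost k (p ++ i ∷ q)
  atMost-raise k p q with k ≟ i
  ... | yes refl = ≤-trans (n≤1+n _) (≤-reflexive (sym (atMost-change-i p q)))
  ... | no k≢i   = ≤-reflexive (sym (atMost-change k p q k≢i))

  module _ {n : ℕ} (1≤i : 1 ≤ i) (i<n : i < n) where

    private
      bounded : ∀ {x y p q} → 1 ≤ y × y ≤ n → Bounded n (p ++ x ∷ q) → Bounded n (p ++ y ∷ q)
      bounded {p = p} b all with All.++⁻ p all
      ... | ps , _ ∷ qs = All.++⁺ ps (b ∷ qs)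

      sort : ∀ {w} → Linked _≤_ w → Sorted w
      sort = Linked⇒AllPairs ≤-trans

      replace-good : ∀ {r r′} A {B} → Good n (A ++ r ∷ B) → Linked _≤_ r′ → Bounded n r′ →
        (∀ A′ l → A ≡ A′ ∷ʳ l → Sorted l → StrictBelow l r → StrictBelow l r′) →
        (∀ b B′ → B ≡ b ∷ B′ → Sorted b → StrictBelow r b → StrictBelow r′ b) →
        Good n (A ++ r′ ∷ B)
      replace-good {r} {r′} A {B} (rows , bounds , columns) row′ bound′ below above
        with rowsA , row ∷ rowsB ← All.++⁻ A rows | boundsA , bound ∷ boundsB ← All.++⁻ A bounds =
        All.++⁺ rowsA (row′ ∷ rowsB) , All.++⁺ boundsA (bound′ ∷ boundsB) ,
        replace-linked A
          (λ A′ l eq ab →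
            let l-sorted = sort (All.head (All.++⁻ʳ A′ (subst (All _) eq rowsA)))
                l-bound  = All.head (All.++⁻ʳ A′ (subst (All _) eq boundsA))
            in strict⇒above (sort row′) l-sorted (All.map proj₁ l-bound) (below A′ l eq l-sorted (above⇒strict ab)))
          (λ { b B′ refl ab →
            let b-sorted = sort (All.head rowsB)
            in strict⇒above b-sorted (sort row′) (All.map proj₁ bound′) (above b B′ refl b-sorted (above⇒strict ab)) })
          columns

    private
      same-shape : ∀ A p q B {x y : ℕ} → map length (A ++ (p ++ y ∷ q) ∷ B) ≡ map length (A ++ (p ++ x ∷ q) ∷ B)
      same-shape A p q B = trans (map-++ length A _) (trans
        (cong (λ z → map length A ++ z ∷ map length B) (trans (length-++ p) (sym (length-++ p))))
        (sym (map-++ length A _)))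

      regroup : ∀ A p q B (y : ℕ) → concat (A ++ (p ++ y ∷ q) ∷ B) ≡ (concat A ++ p) ++ y ∷ q ++ concat B
      regroup A p q B y = trans (sym (concat-++ A _))
        (trans (cong (concat A ++_) (++-assoc p (y ∷ q) (concat B))) (sym (++-assoc (concat A) p _)))

      concat-snoc : ∀ A′ (l p : Word) → concat (A′ ∷ʳ l) ++ p ≡ concat A′ ++ (l ++ p)
      concat-snoc A′ l p = trans (cong (_++ p) (trans (sym (concat-++ A′ (l ∷ []))) (cong (concat A′ ++_) (++-identityʳ l))))
        (++-assoc (concat A′) l p)

    -- Raising a letter can break only the order with its right neighbour and the columns with the
    -- row below, the latter only at threshold `i`. The choice of the last unmatched `i` prevents
    -- the first, and that nothing is pending before it prevents the second.
    raise-good : ∀ A p q B → Good n (A ++ (p ++ i ∷ q) ∷ B) →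
      pending 0 (concat A ++ p) ≡ 0 → unmatched 0 (q ++ concat B) ≡ 0 → Good n (A ++ (p ++ suc i ∷ q) ∷ B)
    raise-good A p q B good pend unm = replace-good A good row′
      (bounded {p = p} (s≤s z≤n , i<n) (All.head (All.++⁻ʳ A (proj₁ (proj₂ good)))))
      below (λ b B′ eq _ col k → ≤-trans (atMost-raise (suc k) p q) (col k))
      where
      row′ : Linked _≤_ (p ++ suc i ∷ q)
      row′ = replace-linked p (λ _ _ _ a≤i → m≤n⇒m≤1+n a≤i) right (All.head (All.++⁻ʳ A (proj₁ good)))
        where
        right : ∀ b bs → q ≡ b ∷ bs → i ≤ b → suc i ≤ b
        -- A second `i` immediately to the right would be unmatched as well, starting from nothing
        -- pending.
        right b bs refl i≤b = ≤∧≢⇒< i≤b λ { refl →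
          case trans (cong (λ k → lone k 0 + unmatched (after (kind i) 0) (bs ++ concat B)) (sym (kind-c i≢1+i))) unm of λ () }
      below : ∀ A′ l → A ≡ A′ ∷ʳ l → Sorted l → StrictBelow l (p ++ i ∷ q) → StrictBelow l (p ++ suc i ∷ q)
      below A′ l refl l-sorted col k with k ≟ i
      ... | no k≢i = subst (atMost (suc k) l ≤_) (atMost-change k p q k≢i) (col k)
      -- If the columns failed, the row below would contain at least as many letters `suc i` as this
      -- row has letters `i`. All of them are pending when `p` begins, and `p` has too few letters
      -- `i` to close them, since it misses the flipped one.
      ... | yes refl = s≤s⁻¹ (subst (atMost (suc i) l <_) (atMost-change-i p q) (≰⇒> λ bad →
        let open ≤-Reasoning
            r = p ++ i ∷ q
            suc-pred-i = suc-pred i {{>-nonZero 1≤i}}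
            lower≤ : atMost i l ≤ atMost (pred i) r
            lower≤ = subst (λ z → atMost z l ≤ atMost (pred i) r) suc-pred-i (col (pred i))
            count≤ : count i r ≤ count (suc i) l
            count≤ = +-cancelˡ-≤ (atMost i l) _ _ (begin
              atMost i l + count i r        ≤⟨ +-monoˡ-≤ (count i r) lower≤ ⟩
              atMost (pred i) r + count i r ≡⟨ subst (λ z → atMost z r ≡ atMost (pred i) r + count z r) suc-pred-i (atMost-suc (pred i) r) ⟨
              atMost i r                    ≤⟨ bad ⟩
              atMost (suc i) l              ≡⟨ atMost-suc i l ⟩
              atMost i l + count (suc i) l  ∎)
            pend-lp : pending 0 (l ++ p) ≡ 0
            pend-lp = n≤0⇒n≡0 (≤-trans (pending-suffix (concat A′) (l ++ p))
                        (≤-reflexive (trans (cong (pending 0) (sym (concat-snoc A′ l p))) pend)))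
        in <-irrefl refl (begin-strict
              count i p                            <⟨ ≤-trans (s≤s (m≤m+n _ (count i q))) (≤-reflexive (sym (count-middle i p q))) ⟩
              count i r                            ≤⟨ count≤ ⟩
              count (suc i) l                      ≤⟨ sorted-pending l-sorted ⟩
              pending 0 l                          ≤⟨ pending-≥ (pending 0 l) p ⟩
              count i p + pending (pending 0 l) p  ≡⟨ cong (count i p +_) (trans (sym (pending-++ 0 l p)) pend-lp) ⟩
              count i p + 0                        ≡⟨ +-identityʳ _ ⟩
              count i p                            ∎)))

    -- The mirror image: now the left neighbour and the row above are at risk, and the two
    -- conditions of the flip exchange their tasks.
    lower-good : ∀ A p q B → Good n (A ++ (p ++ suc i ∷ q) ∷ B) →
      pending 0 (concat A ++ p) ≡ 0 → unmatched 0 (q ++ concat B) ≡ 0 → Good n (A ++ (p ++ i ∷ q) ∷ B)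
    lower-good A p q B good pend unm = replace-good A good row′
      (bounded {p = p} (1≤i , <⇒≤ i<n) (All.head (All.++⁻ʳ A (proj₁ (proj₂ good)))))
      (λ A′ l eq _ col k → ≤-trans (col k) (atMost-raise k p q)) above
      where
      row′ : Linked _≤_ (p ++ i ∷ q)
      row′ = replace-linked p left (λ _ _ _ 1+i≤b → <⇒≤ 1+i≤b) (All.head (All.++⁻ʳ A (proj₁ good)))
        where
        left : ∀ p′ a → p ≡ p′ ∷ʳ a → a ≤ suc i → a ≤ i
        left p′ a refl a≤1+i = s≤s⁻¹ (≤∧≢⇒< a≤1+i λ { refl → case
          ≤-trans (≤-reflexive (cong (λ k → after k 0) (sym kind-o)))
          (≤-trans (pending-suffix (concat A ++ p′) [ suc i ])
            (≤-reflexive (trans (cong (pending 0) (++-assoc (concat A) p′ _)) pend))) of λ () })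
      above : ∀ b B′ → B ≡ b ∷ B′ → Sorted b → StrictBelow (p ++ suc i ∷ q) b → StrictBelow (p ++ i ∷ q) b
      above b B′ refl b-sorted col k with suc k ≟ i
      ... | no 1+k≢i = subst (_≤ atMost k b) (sym (atMost-change (suc k) p q 1+k≢i)) (col k)
      -- On failure the row above would have at least as many letters `i` as this row has letters
      -- `suc i`. Those letters `i` must all be closed by brackets pending after `q`, and `q` misses
      -- the flipped letter.
      ... | yes refl = subst (_≤ atMost k b) (sym (atMost-change-i p q)) (≰⇒> λ bad →
        let open ≤-Reasoning
            r = p ++ suc i ∷ q
            count≤ : count (suc i) r ≤ count i b
            count≤ = +-cancelˡ-≤ (atMost i r) _ _ (begin
              atMost i r + count (suc i) r  ≡⟨ atMost-suc i r ⟨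
              atMost (suc i) r              ≤⟨ col i ⟩
              atMost i b                    ≡⟨ atMost-suc k b ⟩
              atMost k b + count i b        ≤⟨ +-monoˡ-≤ (count i b) bad ⟩
              atMost i r + count i b        ∎)
            unm-b : unmatched (pending 0 q) b ≡ 0
            unm-b = m+n≡0⇒m≡0 _ (trans (sym (unmatched-++ (pending 0 q) b (concat B′)))
                      (m+n≡0⇒n≡0 (unmatched 0 q) (trans (sym (unmatched-++ 0 q (b ++ concat B′))) unm)))
        in <-irrefl refl (begin-strict
              count (suc i) q                            <⟨ ≤-trans (s≤s (m≤n+m _ (count (suc i) p))) (≤-reflexive (sym (count-middle (suc i) p q))) ⟩
              count (suc i) r                            ≤⟨ count≤ ⟩
              count i b                                  ≤⟨ sorted-unmatched (pending 0 q) b-sorted ⟩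
              unmatched (pending 0 q) b + pending 0 q    ≡⟨ cong (_+ pending 0 q) unm-b ⟩
              pending 0 q                                ≤⟨ pending≤ q ⟩
              count (suc i) q                            ∎))

    s-word-transfers : ∀ w → Transfers n w (s-word i w)
    s-word-transfers = s-word-preserves i (Transfers n) transfers-refl transfers-trans raise lower
      where
      find : ∀ (rows : List Word) u {x v} → concat rows ≡ u ++ x ∷ v → ∃[ A ] ∃[ p ] ∃[ q ] ∃[ B ]
        (rows ≡ A ++ (p ++ x ∷ q) ∷ B × u ≡ concat A ++ p × v ≡ q ++ concat B)
      find []       []      ()
      find []       (_ ∷ _) ()
      find (r ∷ rs) u       eq = locate r rs u eq
      raise : ∀ {w w′} → Flip w w′ → Transfers n w w′
      raise (flip-at u v pend unm) rows eq good with find rows u eq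
      ... | A , p , q , B , refl , refl , refl =
        _ , same-shape A p q B , regroup A p q B (suc i) , raise-good A p q B good pend unm
      lower : ∀ {w w′} → Flip w w′ → Transfers n w′ w
      lower (flip-at u v pend unm) rows eq good with find rows u eq
      ... | A , p , q , B , refl , refl , refl =
        _ , same-shape A p q B , regroup A p q B i , lower-good A p q B good pend unm

-- Tableaux and their reading words

chop-concat : ∀ rows → chop (map length rows) (concat rows) ≡ rows
chop-concat []         = refl
chop-concat (r ∷ rows) = cong₂ _∷_ (take-length r) (trans (cong (chop (map length rows)) (drop-length r)) (chop-concat rows))
  where
  take-length : ∀ (r : Word) {w} → take (length r) (r ++ w) ≡ r
  take-length []      = refl
  take-length (x ∷ r) = cong (x ∷_) (take-length r)
  drop-length : ∀ (r : Word) {w} → drop (length r) (r ++ w) ≡ w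
  drop-length []      = refl
  drop-length (x ∷ r) = drop-length r

length-concat : ∀ (rows : List Word) → length (concat rows) ≡ sum (map length rows)
length-concat []         = refl
length-concat (r ∷ rows) = trans (length-++ r) (cong (length r +_) (length-concat rows))

concat-chop : ∀ ls w → length w ≡ sum ls → concat (chop ls w) ≡ w × map length (chop ls w) ≡ ls
concat-chop []       []      eq = refl , refl
concat-chop (l ∷ ls) w       eq =
  let e₁ , e₂ = concat-chop ls (drop l w) (trans (length-drop l w) (trans (cong (_∸ l) eq) (m+n∸m≡n l (sum ls))))
  in trans (cong (take l w ++_) e₁) (take++drop≡id l w) ,
     cong₂ _∷_ (trans (length-take l w) (m≤n⇒m⊓n≡m (≤-trans (m≤m+n l (sum ls)) (≤-reflexive (sym eq))))) e₂

reading : Filling → Word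
reading T = concat (reverse T)

LengthPreserving : (Word → Word) → Set
LengthPreserving F = ∀ w → length (F w) ≡ length w

reverse-onReading : ∀ F T → reverse (onReading F T) ≡ chop (map length (reverse T)) (F (reading T))
reverse-onReading F T = reverse-involutive _

module _ F (F-length : LengthPreserving F) (T : Filling) where
  private
    chopped = concat-chop (map length (reverse T)) (F (reading T)) (trans (F-length (reading T)) (length-concat (reverse T)))

  reading-onReading : reading (onReading F T) ≡ F (reading T)
  reading-onReading = trans (cong concat (reverse-onReading F T)) (proj₁ chopped)

  shape-onReading : map length (reverse (onReading F T)) ≡ map length (reverse T)
  shape-onReading = trans (cong (map length) (reverse-onReading F T)) (proj₂ chopped)

  onReading-∘ : ∀ G → onReading G (onReading F T) ≡ onReading (G ∘ F) T
  onReading-∘ G = cong reverse (cong₂ chop shape-onReading (cong G reading-onReading))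

onReading-id : ∀ F T → F (reading T) ≡ reading T → onReading F T ≡ T
onReading-id F T eq = trans (cong reverse (trans (cong (chop (map length (reverse T))) eq) (chop-concat (reverse T)))) (reverse-involutive T)

^^-length : ∀ F → LengthPreserving F → ∀ k → LengthPreserving (F ^^ k)
^^-length F F-length zero    w = refl
^^-length F F-length (suc k) w = trans (F-length _) (^^-length F F-length k w)

onReading-^^ : ∀ F → LengthPreserving F → ∀ k T → (onReading F ^^ k) T ≡ onReading (F ^^ k) T
onReading-^^ F F-length zero    T = sym (onReading-id id T refl)
onReading-^^ F F-length (suc k) T = trans (cong (onReading F) (onReading-^^ F F-length k T))
  (onReading-∘ (F ^^ k) (^^-length F F-length k) T F)

flipLast-length : ∀ o c h w → length (Brackets.flipLast o c h w) ≡ length w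
flipLast-length o c h [] = refl
flipLast-length o c h (x ∷ w) with Brackets.kind o c x | h
... | Brackets.opening | h     = cong suc (flipLast-length o c (suc h) w)
... | Brackets.closing | suc h = cong suc (flipLast-length o c h w)
... | Brackets.neutral | h     = cong suc (flipLast-length o c h w)
... | Brackets.closing | zero with Brackets.hasUnmatchedClosing o c 0 w
...   | true  = cong suc (flipLast-length o c 0 w)
...   | false = refl

f-word-length : ∀ i → LengthPreserving (f-word i)
f-word-length i = flipLast-length (suc i) i 0

e-word-length : ∀ i → LengthPreserving (e-word i)
e-word-length i w = trans (length-reverse (Brackets.flipLast i (suc i) 0 (reverse w))) (trans (flipLast-length i (suc i) 0 (reverse w)) (length-reverse w))

-- `content` runs through the rows from the top and the reading word from the bottom; an additive
-- statistic does not notice the difference.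
additive-reading : (g : Word → ℕ) → (∀ u v → g (u ++ v) ≡ g u + g v) →
                   ∀ T → g (concat T) ≡ g (reading T)
additive-reading g g-++ []      = refl
additive-reading g g-++ (r ∷ T) = begin
  g (r ++ concat T)              ≡⟨ g-++ r (concat T) ⟩
  g r + g (concat T)             ≡⟨ cong (g r +_) (additive-reading g g-++ T) ⟩
  g r + g (reading T)            ≡⟨ +-comm (g r) _ ⟩
  g (reading T) + g r            ≡⟨ g-++ (reading T) r ⟨
  g (reading T ++ r)             ≡⟨ cong (λ z → g (reading T ++ z)) (++-identityʳ r) ⟨
  g (reading T ++ concat [ r ])  ≡⟨ cong g (concat-++ (reverse T) [ r ]) ⟩
  g (concat (reverse T ∷ʳ r))    ≡⟨ cong (λ z → g (concat z)) (unfold-reverse r T) ⟨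
  g (reading (r ∷ T))            ∎
  where open ≡-Reasoning

content-reading : ∀ k T → content k T ≡ count k (reading T)
content-reading k = additive-reading (count k) (count-++ k)

s-onReading : ∀ i T → s i T ≡ onReading (s-word i) T
s-onReading i T rewrite content-reading i T | content-reading (suc i) T
  with count (suc i) (reading T) ≤ᵇ count i (reading T)
... | true  = onReading-^^ (f-word i) (f-word-length i) (count i (reading T) ∸ count (suc i) (reading T)) T
... | false = onReading-^^ (e-word i) (e-word-length i) (count (suc i) (reading T) ∸ count i (reading T)) T

coxeter-word-length : ∀ m → LengthPreserving (coxeter-word m)
coxeter-word-length zero    w = refl
coxeter-word-length (suc m) w = trans (coxeter-word-length m _) (length-s-word (suc m) w)

-- `coxeter` is folded from its outermost factor `s 1`, while `coxeter-word` recurses on the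
-- innermost one; hence the list of indices is split at its end.
coxeter-onReading : ∀ m T → coxeter (suc m) T ≡ onReading (coxeter-word m) T
coxeter-onReading zero    T = sym (onReading-id id T refl)
coxeter-onReading (suc m) T = begin
  foldr composed id (applyUpTo suc (suc m)) T             ≡⟨ cong (λ is → foldr composed id is T) (applyUpTo-∷ʳ suc m) ⟨
  foldr composed id (applyUpTo suc m ∷ʳ suc m) T          ≡⟨ last-factor (applyUpTo suc m) ⟩
  coxeter (suc m) (s (suc m) T)                           ≡⟨ cong (coxeter (suc m)) (s-onReading (suc m) T) ⟩
  coxeter (suc m) (onReading (s-word (suc m)) T)          ≡⟨ coxeter-onReading m _ ⟩
  onReading (coxeter-word m) (onReading (s-word (suc m)) T) ≡⟨ onReading-∘ (s-word (suc m)) (length-s-word (suc m)) T (coxeter-word m) ⟩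
  onReading (coxeter-word (suc m)) T                      ∎
  where
  open ≡-Reasoning
  composed : ℕ → (Filling → Filling) → Filling → Filling
  composed i g = s i ∘ g
  last-factor : ∀ is → foldr composed id (is ∷ʳ suc m) T ≡ foldr composed id is (s (suc m) T)
  last-factor []       = refl
  last-factor (i ∷ is) = cong (s i) (last-factor is)

coxeter-^^ : ∀ m k T → (coxeter (suc m) ^^ k) T ≡ onReading (coxeter-word m ^^ k) T
coxeter-^^ m zero    T = sym (onReading-id id T refl)
coxeter-^^ m (suc k) T = trans (cong (coxeter (suc m)) (coxeter-^^ m k T)) (trans (coxeter-onReading m _)
  (onReading-∘ (coxeter-word m ^^ k) (^^-length (coxeter-word m) (coxeter-word-length m) k) T (coxeter-word m)))

coxeter-order : ∀ m T → (coxeter (suc m) ^^ suc m) T ≡ T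
coxeter-order m T = trans (coxeter-^^ m (suc m) T) (onReading-id (coxeter-word m ^^ suc m) T (coxeter-word-order m (reading T)))

linked-reverse : ∀ {a} {A : Set a} {R : A → A → Set} {xs : List A} → Linked R xs → Linked (flip R) (reverse xs)
linked-reverse [] = []
linked-reverse [-] = [-]
linked-reverse {R = R} {x ∷ y ∷ xs} (r ∷ l)
  rewrite unfold-reverse x (y ∷ xs) | unfold-reverse y xs =
  snoc (reverse xs) (subst (Linked (flip R)) (unfold-reverse y xs) (linked-reverse l))
  where
  snoc : ∀ zs → Linked (flip R) (zs ∷ʳ y) → Linked (flip R) ((zs ∷ʳ y) ∷ʳ x)
  snoc []             [-]     = r ∷ [-]
  snoc (z ∷ [])       (p ∷ l) = p ∷ snoc [] l
  snoc (z ∷ z′ ∷ zs)  (p ∷ l) = p ∷ snoc (z′ ∷ zs) l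

all-reverse : ∀ {a} {A : Set a} {P : A → Set} {xs : List A} → All P xs → All P (reverse xs)
all-reverse {xs = xs} = All-resp-↭ (↭-sym (↭-reverse xs))

module _ {n : ℕ} {μ : List ℕ} where

  SST⇒good : ∀ {T} → SST n μ T → Good n (reverse T)
  SST⇒good (_ , bounds , rows , columns) = all-reverse rows , all-reverse bounds , linked-reverse columns

  good⇒SST : ∀ {rows} → map length (reverse rows) ≡ μ → Good n rows → SST n μ (reverse rows)
  good⇒SST shape (rows , bounds , columns) = shape , all-reverse bounds , all-reverse rows , linked-reverse columns

  -- Row lengths and concatenation determine a division into rows, so the rows supplied by
  -- `Transfers` are those that `chop` cuts out.
  onReading-closed : ∀ {F} → (∀ w → Transfers n w (F w)) → ∀ {T} → SST n μ T → SST n μ (onReading F T)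
  onReading-closed tr {T} sst with tr (reading T) (reverse T) refl (SST⇒good sst)
  ... | rows , shape , eq , good = subst (SST n μ) (cong reverse same)
          (good⇒SST (trans (reverse-map length rows) (trans (cong reverse shape)
            (trans (cong reverse (reverse-map length T)) (trans (reverse-involutive _) (proj₁ sst))))) good)
    where
    same = trans (sym (chop-concat rows)) (cong₂ chop shape eq)

  coxeter-closed : ∀ m → suc m ≡ n → ∀ T → SST n μ T → SST n μ (coxeter n T)
  coxeter-closed m refl T sst =
    subst (SST n μ) (sym (coxeter-onReading m T)) (onReading-closed (coxeter-transfers m ≤-refl) sst)
    where
    coxeter-transfers : ∀ k → k ≤ m → ∀ w → Transfers n w (coxeter-word k w)
    coxeter-transfers zero    _   w = transfers-refl
    coxeter-transfers (suc k) k<m w =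
      transfers-trans (s-word-transfers (suc k) (s≤s z≤n) (s≤s k<m) w) (coxeter-transfers k (<⇒≤ k<m) _)

-- The degree

-- The exponent of q contributed by a filling to s(1, q, …, q^(n-1)).
degree : Word → ℕ
degree w = sum (map pred w)

degree-++ : ∀ u v → degree (u ++ v) ≡ degree u + degree v
degree-++ u v = trans (cong sum (map-++ pred u v)) (sum-++ (map pred u) (map pred v))

degree-flip : ∀ i {w w′} → 1 ≤ i → Letter.Flip i w w′ → degree w′ ≡ suc (degree w)
degree-flip (suc i) _ (BracketStatistics.flip-at u v _ _)
  rewrite degree-++ u (suc i ∷ v) | degree-++ u (suc (suc i) ∷ v) = +-suc _ _

atMost-s-word : ∀ k i → k ≢ i → ∀ w → atMost k (s-word i w) ≡ atMost k w
atMost-s-word k i k≢i = s-word-invariant i (atMost k) λ { (BracketStatistics.flip-at u v _ _) → atMost-change i k u v k≢i }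

-- The letters 1, ..., m gain 1 each, and each letter m + 1 becomes a 1 and loses m, as far as
-- contents can tell. The term `atMost 0 w` discounts letters 0, which stay put, so that the
-- induction can run over all words.
degree-coxeter-word : ∀ m w → degree (coxeter-word m w) + m * count (suc m) w + atMost 0 w ≡ degree w + atMost m w
degree-coxeter-word zero    w = cong (_+ atMost 0 w) (+-identityʳ _)
degree-coxeter-word (suc m) w = +-cancelʳ-≡ (count (suc m) w′) _ _ (begin
  D + suc m * c₂ + atMost 0 w + count (suc m) w′                 ≡⟨ cong (λ z → D + suc m * z + atMost 0 w + count (suc m) w′) (count-i-s-word (suc m) w) ⟨
  D + suc m * c₁′ + atMost 0 w + c₁′                             ≡⟨ cong (λ z → D + suc m * c₁′ + z + c₁′) (atMost-s-word 0 (suc m) (λ ()) w) ⟨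
  D + suc m * c₁′ + atMost 0 w′ + c₁′                            ≡⟨ lem₁ D m c₁′ (atMost 0 w′) ⟩
  (D + m * c₁′ + atMost 0 w′) + (c₁′ + c₁′)                      ≡⟨ cong (_+ (c₁′ + c₁′)) (degree-coxeter-word m w′) ⟩
  (degree w′ + atMost m w′) + (c₁′ + c₁′)                        ≡⟨ cong₂ (λ x y → (degree w′ + x) + (y + c₁′))
                                                                          (atMost-s-word m (suc m) (<⇒≢ ≤-refl) w) (count-i-s-word (suc m) w) ⟩
  (degree w′ + atMost m w) + (c₂ + c₁′)                          ≡⟨ lem₂ (degree w′) (atMost m w) c₂ c₁′ ⟩
  (degree w′ + c₂) + (atMost m w + c₁′)                          ≡⟨ cong (_+ (atMost m w + c₁′)) (s-word-raise (suc m) degree (degree-flip (suc m) (s≤s z≤n)) w) ⟩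
  (degree w + count (suc m) w) + (atMost m w + c₁′)              ≡⟨ lem₃ (degree w) (count (suc m) w) (atMost m w) c₁′ ⟩
  degree w + (atMost m w + count (suc m) w) + c₁′                ≡⟨ cong (λ z → degree w + z + c₁′) (atMost-suc m w) ⟨
  degree w + atMost (suc m) w + c₁′                              ∎)
  where
  open ≡-Reasoning
  w′  = s-word (suc m) w
  D   = degree (coxeter-word m w′)
  c₂  = count (suc (suc m)) w
  c₁′ = count (suc m) w′
  lem₁ : ∀ D m c a → D + (c + m * c) + a + c ≡ (D + m * c + a) + (c + c)
  lem₁ = solve-∀
  lem₂ : ∀ a b c d → (a + b) + (c + d) ≡ (a + c) + (b + d)
  lem₂ = solve-∀
  lem₃ : ∀ a b c d → (a + b) + (c + d) ≡ a + (c + b) + d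
  lem₃ = solve-∀

atMost-all : ∀ {k w} → All (_≤ k) w → atMost k w ≡ length w
atMost-all all = cong length (filter-all (_≤? _) all)

module _ {m : ℕ} {μ : List ℕ} {T : Filling} (sst : SST (suc m) μ T) where

  private
    good = SST⇒good sst

  bounds-reading : Bounded (suc m) (reading T)
  bounds-reading = All.concat⁺ (proj₁ (proj₂ good))

  length-reading : length (reading T) ≡ sum μ
  length-reading = trans (length-concat (reverse T)) (trans (sum-reverse T) (cong sum (proj₁ sst)))
    where
    sum-reverse : ∀ T → sum (map length (reverse T)) ≡ sum (map length T)
    sum-reverse [] = refl
    sum-reverse (r ∷ T) = trans (cong (sum ∘ map length) (unfold-reverse r T)) (trans (cong sum (map-++ length (reverse T) [ r ]))
      (trans (sum-++ (map length (reverse T)) _) (trans (cong₂ _+_ (sum-reverse T) (+-identityʳ _)) (+-comm _ (length r)))))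

  degree-coxeter : degree (reading (coxeter (suc m) T)) + suc m * count (suc m) (reading T) ≡ degree (reading T) + sum μ
  degree-coxeter = begin
    degree (reading (coxeter (suc m) T)) + (c + m * c) ≡⟨ cong (λ z → degree z + (c + m * c)) reading-coxeter ⟩
    D + (c + m * c)                                    ≡⟨ cong (D +_) (+-comm c _) ⟩
    D + (m * c + c)                                    ≡⟨ +-assoc D _ _ ⟨
    D + m * c + c                                      ≡⟨ cong (_+ c) (+-identityʳ _) ⟨
    D + m * c + 0 + c                                  ≡⟨ cong (λ z → D + m * c + z + c) (atMost-none (All.map proj₁ bounds-reading)) ⟨
    D + m * c + atMost 0 w + c                         ≡⟨ cong (_+ c) (degree-coxeter-word m w) ⟩
    degree w + atMost m w + c                          ≡⟨ +-assoc (degree w) _ _ ⟩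
    degree w + (atMost m w + c)                        ≡⟨ cong (degree w +_) (atMost-suc m w) ⟨
    degree w + atMost (suc m) w                        ≡⟨ cong (degree w +_) (trans (atMost-all (All.map proj₂ bounds-reading)) length-reading) ⟩
    degree w + sum μ                                   ∎
    where
    open ≡-Reasoning
    w = reading T
    c = count (suc m) w
    D = degree (coxeter-word m w)
    reading-coxeter : reading (coxeter (suc m) T) ≡ coxeter-word m w
    reading-coxeter = trans (cong reading (coxeter-onReading m T))
                            (reading-onReading (coxeter-word m) (coxeter-word-length m) T)

degree-coxeter-^^ : ∀ {m μ T} k → SST (suc m) μ T →
  ∃[ M ] degree (reading ((coxeter (suc m) ^^ k) T)) + suc m * M ≡ degree (reading T) + k * sum μ
degree-coxeter-^^ {m} {μ} {T} zero sst = 0 , cong (degree (reading T) +_) (*-zeroʳ m)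
degree-coxeter-^^ {m} {μ} {T} (suc k) sst with degree-coxeter-^^ k sst
... | M , eq = count (suc m) (reading T′) + M , (begin
  D″ + suc m * (c + M)        ≡⟨ lem₁ D″ m c M ⟩
  D″ + suc m * c + suc m * M  ≡⟨ cong (_+ suc m * M) (degree-coxeter (closed k)) ⟩
  D′ + sum μ + suc m * M      ≡⟨ lem₂ D′ (sum μ) (suc m * M) ⟩
  D′ + suc m * M + sum μ      ≡⟨ cong (_+ sum μ) eq ⟩
  D + k * sum μ + sum μ       ≡⟨ lem₃ D (k * sum μ) (sum μ) ⟩
  D + (sum μ + k * sum μ)     ∎)
  where
  open ≡-Reasoning
  T′ = (coxeter (suc m) ^^ k) T
  D″ = degree (reading (coxeter (suc m) T′))
  D′ = degree (reading T′)
  D  = degree (reading T)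
  c  = count (suc m) (reading T′)
  closed : ∀ k → SST (suc m) μ ((coxeter (suc m) ^^ k) T)
  closed zero    = sst
  closed (suc k) = coxeter-closed m refl _ (closed k)
  lem₁ : ∀ D m c M → D + suc m * (c + M) ≡ D + suc m * c + suc m * M
  lem₁ = solve-∀
  lem₂ : ∀ a b c → a + b + c ≡ a + c + b
  lem₂ = solve-∀
  lem₃ : ∀ a b c → a + b + c ≡ a + (c + b)
  lem₃ = solve-∀

degree-filter : ∀ k w → degree (filter (_≤? suc k) w) ≡ degree (filter (_≤? k) w) + count (suc k) w * k
degree-filter k [] = refl
degree-filter k (x ∷ w) with <-cmp x (suc k)
... | tri< (s≤s x≤k) x≢k _
  rewrite filter-accept (_≤? suc k) {xs = w} (m≤n⇒m≤1+n x≤k) | filter-accept (_≤? k) {xs = w} x≤k | count-there w x≢k =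
    trans (cong (pred x +_) (degree-filter k w)) (sym (+-assoc (pred x) _ _))
... | tri≈ _ refl _
  rewrite filter-accept (_≤? suc k) {xs = w} ≤-refl | filter-reject (_≤? k) {x = suc k} {xs = w} 1+n≰n | count-here (suc k) w =
    trans (cong (k +_) (degree-filter k w)) (lem k (degree (filter (_≤? k) w)) (count (suc k) w * k))
  where
  lem : ∀ a b c → a + (b + c) ≡ b + (a + c)
  lem = solve-∀
... | tri> _ x≢k k<x
  rewrite filter-reject (_≤? suc k) {xs = w} (<⇒≱ k<x)
        | filter-reject (_≤? k) {xs = w} (<⇒≱ (<-trans (n<1+n k) k<x)) | count-there w x≢k = degree-filter k w

content-degree : ℕ → Filling → ℕ
content-degree n T = sum (map (λ k → content k T * (k ∸ 1)) (interval n))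

content-degree≡degree : ∀ {m μ T} → SST (suc m) μ T → content-degree (suc m) T ≡ degree (reading T)
content-degree≡degree {m} {μ} {T} sst = trans (by-letters (suc m))
    (cong degree (filter-all (_≤? suc m) (All.map proj₂ (bounds-reading sst))))
  where
  w = reading T
  by-letters : ∀ n → content-degree n T ≡ degree (filter (_≤? n) w)
  by-letters zero = sym (cong degree (filter-none (_≤? 0) (All.map (λ b → <⇒≱ (proj₁ b)) (bounds-reading sst))))
  by-letters (suc n) = begin
    sum (map g (interval (suc n)))          ≡⟨ cong (sum ∘ map g) (applyUpTo-∷ʳ suc n) ⟨
    sum (map g (interval n ∷ʳ suc n))       ≡⟨ cong sum (map-++ g (interval n) _) ⟩
    sum (map g (interval n) ++ [ g (suc n) ]) ≡⟨ sum-++ (map g (interval n)) _ ⟩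
    content-degree n T + (g (suc n) + 0)    ≡⟨ cong₂ _+_ (by-letters n) (trans (+-identityʳ _) (cong (_* n) (content-reading (suc n) T))) ⟩
    degree (filter (_≤? n) w) + count (suc n) w * n ≡⟨ degree-filter n w ⟨
    degree (filter (_≤? suc n) w)           ∎
    where
    open ≡-Reasoning
    g : ℕ → ℕ
    g k = content k T * (k ∸ 1)

-- By strictness of columns an entry with k rows above it is at least k + 1, hence contributes at
-- least k; `κ` adds up these lower bounds.
κ≤degree : ∀ {n μ T} → SST n μ T → κ μ ≤ degree (reading T)
κ≤degree {T = T} (refl , bounds , _ , columns) = ≤-trans (by-rows id (λ _ → refl) T (first bounds) columns) (≤-reflexive (degree-reading T))
  where
  FirstAbove : ℕ → Filling → Set
  FirstAbove k []      = 0 ≤ k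
  FirstAbove k (r ∷ _) = All (k <_) r
  first : ∀ {T n} → All (Bounded n) T → FirstAbove 0 T
  first []      = z≤n
  first (b ∷ _) = All.map proj₁ b
  row : ∀ k r → All (k <_) r → k * length r ≤ degree r
  row k []      []        = ≤-reflexive (*-zeroʳ k)
  row k (suc x ∷ r) (s≤s k≤x ∷ p) = ≤-trans (≤-reflexive (*-suc k (length r))) (+-mono-≤ k≤x (row k r p))
  next : ∀ {k u l} → All (k <_) u → Above u l → All (suc k <_) l
  next p       []        = []
  next (p ∷ q) (l>u ∷ a) = ≤-trans (s≤s p) l>u ∷ next q a
  -- `upTo` is `applyUpTo id`, whose tail is `applyUpTo suc`; a general `f` with unit steps survives
  -- the recursion.
  by-rows : ∀ f → (∀ k → f (suc k) ≡ suc (f k)) → ∀ T → FirstAbove (f 0) T → Linked Above T →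
    sum (zipWith _*_ (applyUpTo f (length (map length T))) (map length T)) ≤ degree (concat T)
  by-rows f step [] _ _ = z≤n
  by-rows f step (r ∷ []) p _ = ≤-trans (+-mono-≤ (row (f 0) r p) z≤n) (≤-reflexive (sym (degree-++ r [])))
  by-rows f step (r ∷ r′ ∷ T) p (a ∷ l) = ≤-trans
    (+-mono-≤ (row (f 0) r p) (by-rows (f ∘ suc) (step ∘ suc) (r′ ∷ T) (subst (λ z → All (z <_) r′) (sym (step 0)) (next p a)) l))
    (≤-reflexive (sym (degree-++ r (concat (r′ ∷ T)))))
  degree-reading : ∀ T → degree (concat T) ≡ degree (reading T)
  degree-reading = additive-reading degree degree-++

-- Tableaux as a list, and the principal specialization

∈-interval : ∀ {n x} → x ∈ interval n ⇔ (1 ≤ x × x ≤ n)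
∈-interval {n} {x} = mk⇔ to from
  where
  to : ∀ {x} → x ∈ interval n → 1 ≤ x × x ≤ n
  to x∈ with _ , i<n , refl ← ∈-applyUpTo⁻ suc x∈ = s≤s z≤n , i<n
  from : ∀ {x} → 1 ≤ x × x ≤ n → x ∈ interval n
  from {suc x} (_ , x<n) = ∈-applyUpTo⁺ suc x<n

words-unique : ∀ n l → Unique (words n l)
words-unique n zero    = [] ∷ []
words-unique n (suc l) = Unique.cartesianProductWith⁺ _∷_ ∷-injective
  (Unique.applyUpTo⁺₁ suc n (λ i<j _ → <⇒≢ (s≤s i<j))) (words-unique n l)

fillings-unique : ∀ n μ → Unique (fillings n μ)
fillings-unique n []      = [] ∷ []
fillings-unique n (l ∷ μ) = Unique.cartesianProductWith⁺ _∷_ ∷-injective (words-unique n l) (fillings-unique n μ)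

∈-words⁺ : ∀ {n w} → Bounded n w → w ∈ words n (length w)
∈-words⁺ []       = here refl
∈-words⁺ (b ∷ bs) = ∈-cartesianProductWith⁺ _∷_ (Equivalence.from ∈-interval b) (∈-words⁺ bs)

∈-words⁻ : ∀ {n} l {w} → w ∈ words n l → length w ≡ l × Bounded n w
∈-words⁻ zero (here refl) = refl , []
∈-words⁻ {n} (suc l) w∈ with ∈-cartesianProductWith⁻ _∷_ (interval n) (words n l) w∈
... | _ , _ , x∈ , w∈′ , refl = let e , b = ∈-words⁻ l w∈′ in cong suc e , Equivalence.to ∈-interval x∈ ∷ b

∈-fillings⁺ : ∀ {n T} → All (Bounded n) T → T ∈ fillings n (map length T)
∈-fillings⁺ []       = here refl
∈-fillings⁺ (b ∷ bs) = ∈-cartesianProductWith⁺ _∷_ (∈-words⁺ b) (∈-fillings⁺ bs)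

∈-fillings⁻ : ∀ {n} μ {T} → T ∈ fillings n μ → map length T ≡ μ × All (Bounded n) T
∈-fillings⁻ [] (here refl) = refl , []
∈-fillings⁻ {n} (l ∷ μ) T∈ with ∈-cartesianProductWith⁻ _∷_ (words n l) (fillings n μ) T∈
... | _ , _ , r∈ , T∈′ , refl =
  let e , b = ∈-words⁻ l r∈
      es , bs = ∈-fillings⁻ μ T∈′
  in cong₂ _∷_ e es , b ∷ bs

tableaux-unique : ∀ n μ → Unique (tableaux n μ)
tableaux-unique n μ = Unique.filter⁺ semistandard? (fillings-unique n μ)

∈-tableaux : ∀ {n μ T} → T ∈ tableaux n μ ⇔ SST n μ T
∈-tableaux {n} {μ} {T} = mk⇔ to from
  where
  to : T ∈ tableaux n μ → SST n μ T
  to T∈ with T∈′ , ss ← ∈-filter⁻ semistandard? {xs = fillings n μ} T∈ = let e , b = ∈-fillings⁻ μ T∈′ in e , b , ss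
  from : SST n μ T → T ∈ tableaux n μ
  from (refl , b , ss) = ∈-filter⁺ semistandard? (∈-fillings⁺ b) ss

-- Arithmetic of polynomials up to trailing zeros

coeff-+ : ∀ f g k → coeff (f +ₚ g) k ≡ coeff f k + coeff g k
coeff-+ []      g       k       = refl
coeff-+ (b ∷ f) []      zero    = sym (+-identityʳ b)
coeff-+ (b ∷ f) []      (suc k) = sym (+-identityʳ (coeff f k))
coeff-+ (b ∷ f) (d ∷ g) zero    = refl
coeff-+ (b ∷ f) (d ∷ g) (suc k) = coeff-+ f g k

coeff-map : ∀ b g k → coeff (map (b *_) g) k ≡ b * coeff g k
coeff-map b []      k       = sym (*-zeroʳ b)
coeff-map b (d ∷ g) zero    = refl
coeff-map b (d ∷ g) (suc k) = coeff-map b g k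

coeff-* : ∀ b f g k → coeff ((b ∷ f) *ₚ g) k ≡ b * coeff g k + coeff (0 ∷ (f *ₚ g)) k
coeff-* b f g k = trans (coeff-+ (map (b *_) g) _ k) (cong (_+ coeff (0 ∷ (f *ₚ g)) k) (coeff-map b g k))

*ₚ-congˡ : ∀ f g g′ → g ≈ₚ g′ → (f *ₚ g) ≈ₚ (f *ₚ g′)
*ₚ-congˡ []      g g′ q k = refl
*ₚ-congˡ (b ∷ f) g g′ q k = trans (coeff-* b f g k)
  (trans (cong₂ _+_ (cong (b *_) (q k)) (tail k)) (sym (coeff-* b f g′ k)))
  where
  tail : ∀ k → coeff (0 ∷ (f *ₚ g)) k ≡ coeff (0 ∷ (f *ₚ g′)) k
  tail zero    = refl
  tail (suc k) = *ₚ-congˡ f g g′ q k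

*ₚ-congʳ : ∀ f f′ g → f ≈ₚ f′ → (f *ₚ g) ≈ₚ (f′ *ₚ g)
*ₚ-congʳ []      []       g p k = refl
*ₚ-congʳ []      (b ∷ f′) g p k = sym (trans (coeff-* b f′ g k)
  (cong₂ _+_ (cong (_* coeff g k) (sym (p 0))) (tail k)))
  where
  tail : ∀ k → coeff (0 ∷ (f′ *ₚ g)) k ≡ 0
  tail zero    = refl
  tail (suc k) = sym (*ₚ-congʳ [] f′ g (p ∘ suc) k)
*ₚ-congʳ (b ∷ f) []       g p k = trans (coeff-* b f g k)
  (cong₂ _+_ (cong (_* coeff g k) (p 0)) (tail k))
  where
  tail : ∀ k → coeff (0 ∷ (f *ₚ g)) k ≡ 0
  tail zero    = refl
  tail (suc k) = *ₚ-congʳ f [] g (p ∘ suc) k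
*ₚ-congʳ (b ∷ f) (d ∷ f′) g p k = trans (coeff-* b f g k)
  (trans (cong₂ _+_ (cong (_* coeff g k) (p 0)) (tail k)) (sym (coeff-* d f′ g k)))
  where
  tail : ∀ k → coeff (0 ∷ (f *ₚ g)) k ≡ coeff (0 ∷ (f′ *ₚ g)) k
  tail zero    = refl
  tail (suc k) = *ₚ-congʳ f f′ g (p ∘ suc) k

-- A wrapper of _≈ₚ_ from which Agda can infer the two polynomials.
infix 4 _≋_
record _≋_ (f g : Poly) : Set where
  constructor coeffs
  field at : f ≈ₚ g
open _≋_

≋-reflexive : ∀ {f g} → f ≡ g → f ≋ g
≋-reflexive refl = coeffs λ _ → refl

≋-sym : ∀ {f g} → f ≋ g → g ≋ f
≋-sym p = coeffs λ k → sym (at p k)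

≋-trans : ∀ {f g h} → f ≋ g → g ≋ h → f ≋ h
≋-trans p q = coeffs λ k → trans (at p k) (at q k)

0∷-cong : ∀ {f g} → f ≋ g → 0 ∷ f ≋ 0 ∷ g
0∷-cong p = coeffs λ { zero → refl ; (suc k) → at p k }

+ₚ-cong : ∀ {f f′ g g′} → f ≋ f′ → g ≋ g′ → f +ₚ g ≋ f′ +ₚ g′
+ₚ-cong {f} {f′} {g} {g′} p q =
  coeffs λ k → trans (coeff-+ f g k) (trans (cong₂ _+_ (at p k) (at q k)) (sym (coeff-+ f′ g′ k)))

*ₚ-cong : ∀ {f f′ g g′} → f ≋ f′ → g ≋ g′ → f *ₚ g ≋ f′ *ₚ g′
*ₚ-cong {f} {f′} {g} {g′} p q = coeffs λ k → trans (*ₚ-congʳ f f′ g (at p) k) (*ₚ-congˡ f′ g g′ (at q) k)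

monomial : ℕ → Poly
monomial zero    = 1 ∷ []
monomial (suc k) = 0 ∷ monomial k

shift : ℕ → Poly → Poly
shift zero    f = f
shift (suc k) f = 0 ∷ shift k f

monomial-* : ∀ k g → monomial k *ₚ g ≋ shift k g
monomial-* zero g = coeffs λ k → trans (coeff-* 1 [] g k) (trans (cong₂ _+_ (*-identityˡ _) (tail k)) (+-identityʳ _))
  where
  tail : ∀ k → coeff (0 ∷ []) k ≡ 0
  tail zero    = refl
  tail (suc k) = refl
monomial-* (suc k) g = ≋-trans (coeffs (coeff-* 0 (monomial k) g)) (0∷-cong (monomial-* k g))

shift-monomial : ∀ j k → shift j (monomial k) ≡ monomial (j + k)
shift-monomial zero    k = refl
shift-monomial (suc j) k = cong (0 ∷_) (shift-monomial j k)

shift-+ : ∀ k f g → shift k (f +ₚ g) ≡ shift k f +ₚ shift k g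
shift-+ zero    f g = refl
shift-+ (suc k) f g = cong (0 ∷_) (shift-+ k f g)

shift-[] : ∀ k → shift k [] ≋ []
shift-[] zero    = ≋-reflexive refl
shift-[] (suc k) = coeffs λ { zero → refl ; (suc j) → at (shift-[] k) j }

monomial-+ : ∀ {f g} j k → f ≋ monomial j → g ≋ monomial k → f *ₚ g ≋ monomial (j + k)
monomial-+ j k p q = ≋-trans (*ₚ-cong p q) (≋-trans (monomial-* j (monomial k)) (≋-reflexive (shift-monomial j k)))

open RawSemiringDefs ℕ[q] using () renaming (_^_ to _^ₚ_)

^-monomial : ∀ {f} j k → f ≋ monomial j → f ^ₚ k ≋ monomial (k * j)
^-monomial j zero    p = ≋-reflexive refl
^-monomial j (suc k) p = monomial-+ j (k * j) p (^-monomial j k p)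

q^-monomial : ∀ k → q^ k ≋ monomial k
q^-monomial k = subst (λ z → q^ k ≋ monomial z) (*-identityʳ k) (^-monomial 1 k (≋-reflexive refl))

weight-monomial : ∀ T ks → foldr (λ k acc → ((q^ (k ∸ 1)) ^ₚ content k T) *ₚ acc) (1 ∷ []) ks ≋
                  monomial (sum (map (λ k → content k T * (k ∸ 1)) ks))
weight-monomial T []       = ≋-reflexive refl
weight-monomial T (k ∷ ks) = monomial-+ (content k T * (k ∸ 1)) _
  (^-monomial (k ∸ 1) (content k T) (q^-monomial (k ∸ 1))) (weight-monomial T ks)

generating : {A : Set} → (A → ℕ) → List A → Poly
generating e = foldr (λ x acc → monomial (e x) +ₚ acc) []

foldr-generating : {A : Set} (W : A → Poly) (e : A → ℕ) (xs : List A) → (∀ {x} → x ∈ xs → W x ≋ monomial (e x)) →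
  foldr (λ x acc → W x +ₚ acc) [] xs ≋ generating e xs
foldr-generating W e []       p = ≋-reflexive refl
foldr-generating W e (x ∷ xs) p = +ₚ-cong (p (here refl)) (foldr-generating W e xs (p ∘ there))

shift-generating : {A : Set} (k : ℕ) (e : A → ℕ) (xs : List A) → (∀ {x} → x ∈ xs → k ≤ e x) →
  shift k (generating (λ x → e x ∸ k) xs) ≋ generating e xs
shift-generating k e []       p = shift-[] k
shift-generating k e (x ∷ xs) p = ≋-trans (≋-reflexive (shift-+ k (monomial (e x ∸ k)) _))
  (+ₚ-cong (≋-reflexive (trans (shift-monomial k (e x ∸ k)) (cong monomial (m+[n∸m]≡n (p (here refl))))))
    (shift-generating k e xs (p ∘ there)))

exponent : List ℕ → Filling → ℕ
exponent μ T = degree (reading T) ∸ κ μ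

-- q^(-κ) s(1, q, …, q^(n-1)); exponents are not truncated, by κ≤degree.
principal : ℕ → List ℕ → Poly
principal n μ = generating (exponent μ) (tableaux n μ)

principal-schur : ∀ m μ → (q^ (κ μ)) *ₚ principal (suc m) μ ≈ₚ schur ℕ[q] (suc m) μ (λ k → q^ (k ∸ 1))
principal-schur m μ = at
  (≋-trans (*ₚ-cong (q^-monomial (κ μ)) (≋-reflexive {principal (suc m) μ} refl))
  (≋-trans (monomial-* (κ μ) (principal (suc m) μ))
  (≋-trans (shift-generating (κ μ) (degree ∘ reading) (tableaux (suc m) μ) 
    (λ {T} T∈ → κ≤degree {suc m} (Equivalence.to (∈-tableaux {suc m} {μ} {T}) T∈)))
  (≋-sym (foldr-generating (λ T → foldr (λ k acc → ((q^ (k ∸ 1)) ^ₚ content k T) *ₚ acc) (1 ∷ []) (interval (suc m)))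
    (degree ∘ reading) (tableaux (suc m) μ)
    (λ {T} T∈ → ≋-trans (weight-monomial T (interval (suc m)))
      (≋-reflexive (cong monomial (content-degree≡degree {m} {μ} (Equivalence.to (∈-tableaux {suc m} {μ} {T}) T∈))))))))))

-- Cyclic sieving

private
  variable
    c ℓ₁ ℓ₂ : Level
    A : Set

-- Evaluation at roots of unity

module Evaluation (K : HeytingField c ℓ₁ ℓ₂) where
  open InField K
  open HeytingField K using (tight)
  ring : CommutativeRing c ℓ₁
  ring = HeytingCommutativeRing.commutativeRing (HeytingField.heytingCommutativeRing K)
  private module R = CommutativeRing ring
  open R using (Carrier; _≈_; _-_; 0#; 1#; semiring; setoid)
    renaming (refl to ≈-refl; sym to ≈-sym; trans to ≈-trans; _+_ to _⊕_; _*_ to _⊗_)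
  open RawSemiringDefs (Semiring.rawSemiring semiring) using (_^_)
  open SemiringExp semiring using (^-homo-*; ^-assocʳ)
  open SetoidReasoning setoid

  fromℕ-+ : ∀ a b → fromℕ (a + b) ≈ fromℕ a ⊕ fromℕ b
  fromℕ-+ = MonoidMult.×-homo-+ R.+-monoid 1#

  eval-+ : ∀ f g x → eval (f +ₚ g) x ≈ eval f x ⊕ eval g x
  eval-+ []      g       x = ≈-sym (R.+-identityˡ _)
  eval-+ (b ∷ f) []      x = ≈-sym (R.+-identityʳ _)
  eval-+ (b ∷ f) (d ∷ g) x = begin
    fromℕ (b + d) ⊕ x ⊗ eval (f +ₚ g) x                 ≈⟨ R.+-cong (fromℕ-+ b d) (R.*-congˡ (eval-+ f g x)) ⟩
    (fromℕ b ⊕ fromℕ d) ⊕ x ⊗ (eval f x ⊕ eval g x)     ≈⟨ R.+-congˡ (R.distribˡ x _ _) ⟩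
    (fromℕ b ⊕ fromℕ d) ⊕ (x ⊗ eval f x ⊕ x ⊗ eval g x) ≈⟨ interchange _ _ _ _ ⟩
    (fromℕ b ⊕ x ⊗ eval f x) ⊕ (fromℕ d ⊕ x ⊗ eval g x) ∎
    where
    interchange : ∀ p q r s → (p ⊕ q) ⊕ (r ⊕ s) ≈ (p ⊕ r) ⊕ (q ⊕ s)
    interchange p q r s = begin
      (p ⊕ q) ⊕ (r ⊕ s) ≈⟨ R.+-assoc p q _ ⟩
      p ⊕ (q ⊕ (r ⊕ s)) ≈⟨ R.+-congˡ (≈-sym (R.+-assoc q r s)) ⟩
      p ⊕ ((q ⊕ r) ⊕ s) ≈⟨ R.+-congˡ (R.+-congʳ (R.+-comm q r)) ⟩
      p ⊕ ((r ⊕ q) ⊕ s) ≈⟨ R.+-congˡ (R.+-assoc r q s) ⟩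
      p ⊕ (r ⊕ (q ⊕ s)) ≈⟨ ≈-sym (R.+-assoc p r _) ⟩
      (p ⊕ r) ⊕ (q ⊕ s) ∎

  eval-monomial : ∀ k x → eval (monomial k) x ≈ x ^ k
  eval-monomial zero    x = ≈-trans (R.+-cong (R.+-identityʳ 1#) (R.zeroʳ x)) (R.+-identityʳ 1#)
  eval-monomial (suc k) x = ≈-trans (R.+-identityˡ _) (R.*-congˡ (eval-monomial k x))

  Σ[_] : (A → Carrier) → List A → Carrier
  Σ[ h ] = foldr (λ y acc → h y ⊕ acc) 0#

  eval-generating : (e : A → ℕ) (xs : List A) (x : Carrier) → eval (generating e xs) x ≈ Σ[ (λ y → x ^ e y) ] xs
  eval-generating e []       x = ≈-refl
  eval-generating e (y ∷ xs) x = ≈-trans (eval-+ (monomial (e y)) _ x)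
    (R.+-cong (eval-monomial (e y) x) (eval-generating e xs x))

  Σ-cong : (h h′ : A → Carrier) (xs : List A) → (∀ {x} → x ∈ xs → h x ≈ h′ x) → Σ[ h ] xs ≈ Σ[ h′ ] xs
  Σ-cong h h′ []       p = ≈-refl
  Σ-cong h h′ (x ∷ xs) p = R.+-cong (p (here refl)) (Σ-cong h h′ xs (p ∘ there))

  Σ-map : (h : A → Carrier) (f : A → A) (xs : List A) → Σ[ h ] (map f xs) ≡ Σ[ h ∘ f ] xs
  Σ-map h f []       = refl
  Σ-map h f (x ∷ xs) = cong (h (f x) ⊕_) (Σ-map h f xs)

  Σ-scale : (ζ : Carrier) (h : A → Carrier) (xs : List A) → Σ[ (λ x → ζ ⊗ h x) ] xs ≈ ζ ⊗ Σ[ h ] xs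
  Σ-scale ζ h []       = ≈-sym (R.zeroʳ ζ)
  Σ-scale ζ h (x ∷ xs) = ≈-trans (R.+-congˡ (Σ-scale ζ h xs)) (≈-sym (R.distribˡ ζ _ _))

  Σ-↭ : (h : A → Carrier) {xs ys : List A} → xs ↭ ys → Σ[ h ] xs ≈ Σ[ h ] ys
  Σ-↭ h _↭_.refl     = ≈-refl
  Σ-↭ h (prep x p)   = R.+-congˡ (Σ-↭ h p)
  Σ-↭ h (swap x y p) = begin
    h x ⊕ (h y ⊕ _) ≈⟨ ≈-sym (R.+-assoc _ _ _) ⟩
    (h x ⊕ h y) ⊕ _ ≈⟨ R.+-cong (R.+-comm _ _) (Σ-↭ h p) ⟩
    (h y ⊕ h x) ⊕ _ ≈⟨ R.+-assoc _ _ _ ⟩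
    h y ⊕ (h x ⊕ _) ∎
  Σ-↭ h (_↭_.trans p q) = ≈-trans (Σ-↭ h p) (Σ-↭ h q)

  Σ-one : (h : A → Carrier) (xs : List A) → (∀ x → h x ≈ 1#) → Σ[ h ] xs ≈ fromℕ (length xs)
  Σ-one h []       p = ≈-refl
  Σ-one h (x ∷ xs) p = R.+-cong (p x) (Σ-one h xs p)

  1^ : ∀ {x} k → x ≈ 1# → x ^ k ≈ 1#
  1^ zero    p = ≈-refl
  1^ (suc k) p = ≈-trans (R.*-cong p (1^ k p)) (R.*-identityˡ 1#)

  ^-multiple : ∀ {x} d k → x ^ d ≈ 1# → x ^ (k * d) ≈ 1#
  ^-multiple {x} d k p = ≈-trans (R.reflexive (cong (x ^_) (*-comm k d))) (≈-trans (≈-sym (^-assocʳ x d k)) (1^ k p))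

  -- Uses tightness of the apartness relation: if z were apart from 0, it could be cancelled.
  scaled-by-nonunit : ∀ ζ z → ¬ (ζ ≈ 1#) → z ≈ ζ ⊗ z → z ≈ 0#
  scaled-by-nonunit ζ z ζ≉1 z≈ζz = proj₁ (tight z 0#) λ z#0 →
    let z⁻¹ , _ , right = HeytingField.#⇒invertible K z#0
        zz⁻¹≈1 = ≈-trans (R.*-congʳ (≈-sym z-0≈z)) right
    in ζ≉1 (begin
      ζ             ≈⟨ ≈-sym (R.*-identityʳ ζ) ⟩
      ζ ⊗ 1#        ≈⟨ R.*-congˡ (≈-sym zz⁻¹≈1) ⟩
      ζ ⊗ (z ⊗ z⁻¹) ≈⟨ ≈-sym (R.*-assoc ζ z _) ⟩
      (ζ ⊗ z) ⊗ z⁻¹ ≈⟨ R.*-congʳ (≈-sym z≈ζz) ⟩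
      z ⊗ z⁻¹       ≈⟨ zz⁻¹≈1 ⟩
      1#            ∎)
    where
    z-0≈z : z - 0# ≈ z
    z-0≈z = ≈-trans (R.+-congˡ (RingProperties.-0#≈0# (CommutativeRing.ring ring))) (R.+-identityʳ z)

  primitive-divides : ∀ {d ω} a → IsPrimitiveRoot d ω → ω ^ a ≈ 1# → d ∣ a
  primitive-divides {suc d} {ω} a (_ , ω^d≈1 , least) ω^a≈1 with a % suc d in eq
  ... | zero = m%n≡0⇒n∣m a (suc d) eq
  ... | suc r = ⊥-elim (least (suc r) z<s (subst (_< suc d) eq (m%n<n a (suc d))) (begin
    ω ^ suc r                              ≈⟨ ≈-sym (R.*-identityʳ _) ⟩
    ω ^ suc r ⊗ 1#                         ≈⟨ R.*-congˡ (≈-sym (^-multiple (suc d) (a / suc d) ω^d≈1)) ⟩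
    ω ^ suc r ⊗ ω ^ (a / suc d * suc d)    ≈⟨ ≈-sym (^-homo-* ω (suc r) _) ⟩
    ω ^ (suc r + a / suc d * suc d)        ≡⟨ cong (λ z → ω ^ (z + a / suc d * suc d)) eq ⟨
    ω ^ (a % suc d + a / suc d * suc d)    ≡⟨ cong (ω ^_) (m≡m%n+[m/n]*n a (suc d)) ⟨
    ω ^ a                                  ≈⟨ ω^a≈1 ⟩
    1#                                     ∎))

order-divides : ∀ {n k d} → HasOrder n k d → d ∣ n
order-divides {n} {k} {suc d} (_ , n∣dk , least) with n % suc d in eq
... | zero = m%n≡0⇒n∣m n (suc d) eq
... | suc r = ⊥-elim (<-irrefl refl (<-≤-trans (subst (_< suc d) eq (m%n<n n (suc d))) (least (suc r) z<s n∣rk)))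
  where
  split : n * k ≡ (n / suc d) * (suc d * k) + suc r * k
  split = trans (cong (_* k) (m≡m%n+[m/n]*n n (suc d))) (trans (cong (λ z → (z + n / suc d * suc d) * k) eq) (lem (suc r) (n / suc d) (suc d) k))
    where
    lem : ∀ r q d k → (r + q * d) * k ≡ q * (d * k) + r * k
    lem = solve-∀
  n∣rk : n ∣ suc r * k
  n∣rk = ∣m+n∣m⇒∣n (subst (n ∣_) split (m∣m*n k)) (∣-trans n∣dk (n∣m*n (n / suc d)))

^^-+ : (g : A → A) (j k : ℕ) (x : A) → (g ^^ (j + k)) x ≡ (g ^^ j) ((g ^^ k) x)
^^-+ g zero    k x = refl
^^-+ g (suc j) k x = cong g (^^-+ g j k x)

^^-multiple : (g : A → A) (n : ℕ) (x : A) → (g ^^ n) x ≡ x → ∀ q → (g ^^ (q * n)) x ≡ x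
^^-multiple g n x eq zero    = refl
^^-multiple g n x eq (suc q) = trans (^^-+ g n (q * n) x) (trans (cong (g ^^ n) (^^-multiple g n x eq q)) eq)

-- Orbits, fixed points and the values of the polynomial

module _ (m : ℕ) (μ : List ℕ) (coprime : gcd (suc m) (sum μ) ≡ 1) where
  private
    n = suc m
    g = coxeter n
    X = SST n μ

  power-closed : ∀ k {T} → X T → X ((g ^^ k) T)
  power-closed zero    x = x
  power-closed (suc k) x = coxeter-closed {n} {μ} m refl _ (power-closed k x)

  -- The degree modulo n grows by |μ| under the Coxeter element, and |μ| is invertible modulo n.
  fixed⇒multiple : ∀ k {T} → X T → (g ^^ k) T ≡ T → n ∣ k
  fixed⇒multiple k {T} x eq with degree-coxeter-^^ {m} {μ} k x
  ... | M , deg = coprime-divisor {n} {sum μ} {k} (gcd≡1⇒coprime {n} {sum μ} coprime)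
    (subst (n ∣_) (trans n*M≡k*s (*-comm k (sum μ))) (m∣m*n M))
    where
    n*M≡k*s : n * M ≡ k * sum μ
    n*M≡k*s = +-cancelˡ-≡ (degree (reading T)) _ _ (subst (λ z → degree (reading z) + n * M ≡ degree (reading T) + k * sum μ) eq deg)

  orbit-size : ∀ T → X T → Orbit g T HasSize n
  orbit-size T x = applyUpTo (λ k → (g ^^ k) T) n , unique , (λ y → mk⇔ to from) , length-applyUpTo (λ k → (g ^^ k) T) n
    where
    unique = Unique.applyUpTo⁺₁ (λ k → (g ^^ k) T) n λ {i} {j} i<j j<n eq →
      let t = j ∸ i
          n∣t = fixed⇒multiple t (power-closed i {T} x)
                  (trans (sym (^^-+ g t i T)) (trans (cong (λ z → (g ^^ z) T) (m∸n+n≡m (<⇒≤ i<j))) (sym eq)))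
      in <-irrefl refl (<-≤-trans (≤-<-trans (m∸n≤m j i) j<n) (∣⇒≤ {{>-nonZero {t} (m<n⇒0<n∸m {i} {j} i<j)}} n∣t))
    to : ∀ {y} → y ∈ applyUpTo (λ k → (g ^^ k) T) n → Orbit g T y
    to y∈ with k , _ , eq ← ∈-applyUpTo⁻ (λ k → (g ^^ k) T) y∈ = k , sym eq
    from : ∀ {y} → Orbit g T y → y ∈ applyUpTo (λ k → (g ^^ k) T) n
    from (k , refl) = subst (_∈ applyUpTo (λ k → (g ^^ k) T) n) (sym reduce) (∈-applyUpTo⁺ (λ k → (g ^^ k) T) (m%n<n k n))
      where
      reduce : (g ^^ k) T ≡ (g ^^ (k % n)) T
      reduce = trans (cong (λ z → (g ^^ z) T) (m≡m%n+[m/n]*n k n))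
        (trans (^^-+ g (k % n) (k / n * n) T) (cong (g ^^ (k % n)) (^^-multiple g n T (coxeter-order m T) (k / n))))

  private
    tabs = tableaux n μ
    inTabs : ∀ {T} → X T → T ∈ tabs
    inTabs {T} = Equivalence.from (∈-tableaux {n} {μ} {T})
    fromTabs : ∀ {T} → T ∈ tabs → X T
    fromTabs {T} = Equivalence.to (∈-tableaux {n} {μ} {T})

  coxeter-permutes : map g tabs ↭ tabs
  coxeter-permutes = ∼bag⇒↭ (unique∧set⇒bag (Unique.map⁺ injective (tableaux-unique n μ)) (tableaux-unique n μ) (mk⇔ to from))
    where
    injective : ∀ {T T′} → g T ≡ g T′ → T ≡ T′
    injective {T} {T′} eq = trans (sym (inverse T)) (trans (cong (g ^^ m) eq) (inverse T′))
      where
      inverse : ∀ T → (g ^^ m) (g T) ≡ T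
      inverse T = trans (sym (^^-suc g m T)) (coxeter-order m T)
    to : ∀ {T} → T ∈ map g tabs → T ∈ tabs
    to T∈ with T′ , T′∈ , refl ← ∈-map⁻ g T∈ = inTabs (coxeter-closed {n} {μ} m refl T′ (fromTabs T′∈))
    from : ∀ {T} → T ∈ tabs → T ∈ map g tabs
    from {T} T∈ = subst (_∈ map g tabs) (coxeter-order m T) (∈-map⁺ g (inTabs (power-closed m (fromTabs T∈))))

  exponent-coxeter : ∀ {T} → X T → ∃[ M ] exponent μ (g T) + n * M ≡ exponent μ T + sum μ
  exponent-coxeter {T} x = count n (reading T) , descend {degree (reading (g T))} {degree (reading T)}
      (κ≤degree {n} {μ} (coxeter-closed {n} {μ} m refl T x)) (κ≤degree {n} {μ} x) (degree-coxeter {m} {μ} {T} x)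
    where
    open ≡-Reasoning
    descend : ∀ {a b k p q} → k ≤ a → k ≤ b → a + p ≡ b + q → a ∸ k + p ≡ b ∸ k + q
    descend {a} {b} {k} {p} {q} k≤a k≤b eq = +-cancelˡ-≡ k _ _ (begin
      k + (a ∸ k + p) ≡⟨ +-assoc k (a ∸ k) p ⟨
      k + (a ∸ k) + p ≡⟨ cong (_+ p) (m+[n∸m]≡n k≤a) ⟩
      a + p           ≡⟨ eq ⟩
      b + q           ≡⟨ cong (_+ q) (m+[n∸m]≡n k≤b) ⟨
      k + (b ∸ k) + q ≡⟨ +-assoc k (b ∸ k) q ⟩
      k + (b ∸ k + q) ∎)

  module _ (K : HeytingField c ℓ₁ ℓ₂) where
    open InField K
    open Evaluation K
    private module R = CommutativeRing ring
    open R using (_≈_; 0#; 1#; setoid)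
      renaming (refl to ≈-refl; sym to ≈-sym; trans to ≈-trans; _*_ to _⊗_)
    open RawSemiringDefs (Semiring.rawSemiring (CommutativeRing.semiring ring)) using (_^_)
    open SemiringExp (CommutativeRing.semiring ring) using (^-homo-*)
    open SetoidReasoning setoid

    principal-at-one : ∀ {ω} → ω ≈ 1# → eval (principal n μ) ω ≈ fromℕ (length tabs)
    principal-at-one {ω} ω≈1 = ≈-trans (eval-generating (exponent μ) tabs ω) (Σ-one _ tabs (λ T → 1^ (exponent μ T) ω≈1))

    -- Because d divides n, powers of ω see exponents modulo n, so the Coxeter element multiplies
    -- each summand by the factor `ω ^ sum μ`. This factor is not 1, since d would then divide both
    -- n and |μ|. Reordering the sum along the permutation of the tableaux finishes the argument.
    principal-at-root : ∀ {d ω} → d ∣ n → IsPrimitiveRoot d ω → d ≢ 1 → eval (principal n μ) ω ≈ 0#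
    principal-at-root {d} {ω} d∣n prim d≢1 = ≈-trans (eval-generating (exponent μ) tabs ω)
        (scaled-by-nonunit (ω ^ sum μ) (Σ[ h ] tabs) ζ≉1 rotate)
      where
      h : Filling → CommutativeRing.Carrier ring
      h T = ω ^ exponent μ T
      ζ≉1 : ¬ (ω ^ sum μ ≈ 1#)
      ζ≉1 eq = d≢1 (∣1⇒≡1 (subst (d ∣_) coprime (gcd-greatest d∣n (primitive-divides (sum μ) prim eq))))
      ω^n≈1 : ω ^ n ≈ 1#
      ω^n≈1 = ≈-trans (R.reflexive (cong (ω ^_) (_∣_.equality d∣n))) (^-multiple d (quotient d∣n) (proj₁ (proj₂ prim)))
      step : ∀ {T} → T ∈ tabs → h (g T) ≈ ω ^ sum μ ⊗ h T
      step {T} T∈ = let M , eq = exponent-coxeter (fromTabs T∈) in begin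
        h (g T)                             ≈⟨ ≈-sym (R.*-identityʳ _) ⟩
        h (g T) ⊗ 1#                        ≈⟨ R.*-congˡ (≈-sym (^-multiple n M ω^n≈1)) ⟩
        h (g T) ⊗ ω ^ (M * n)               ≡⟨ cong (λ z → h (g T) ⊗ ω ^ z) (*-comm M n) ⟩
        h (g T) ⊗ ω ^ (n * M)               ≈⟨ ≈-sym (^-homo-* ω (exponent μ (g T)) (n * M)) ⟩
        ω ^ (exponent μ (g T) + n * M)      ≡⟨ cong (ω ^_) eq ⟩
        ω ^ (exponent μ T + sum μ)          ≈⟨ ^-homo-* ω (exponent μ T) (sum μ) ⟩
        h T ⊗ ω ^ sum μ                     ≈⟨ R.*-comm _ _ ⟩
        ω ^ sum μ ⊗ h T                     ∎
      rotate : Σ[ h ] tabs ≈ ω ^ sum μ ⊗ Σ[ h ] tabs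
      rotate = begin
        Σ[ h ] tabs                         ≈⟨ ≈-sym (Σ-↭ h coxeter-permutes) ⟩
        Σ[ h ] (map g tabs)                 ≡⟨ Σ-map h g tabs ⟩
        Σ[ h ∘ g ] tabs                     ≈⟨ Σ-cong (h ∘ g) (λ T → ω ^ sum μ ⊗ h T) tabs step ⟩
        Σ[ (λ T → ω ^ sum μ ⊗ h T) ] tabs   ≈⟨ Σ-scale (ω ^ sum μ) h tabs ⟩
        ω ^ sum μ ⊗ Σ[ h ] tabs             ∎

  cyclic-sieving : ∀ {c ℓ₁ ℓ₂} → CyclicSieving c ℓ₁ ℓ₂ X n g (principal n μ)
  cyclic-sieving {c} {ℓ₁} {ℓ₂} = record
    { action = record { closed = coxeter-closed {n} {μ} m refl ; period = λ T _ → coxeter-order m T }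
    ; sieve  = sieve
    }
    where
    sieve : ∀ k d → HasOrder n k d → ∃[ size ] (Fixed X (g ^^ k) HasSize size ×
      (∀ (K : HeytingField c ℓ₁ ℓ₂) → let open InField K in
       CharacteristicZero → ∀ ω → IsPrimitiveRoot d ω → HeytingField._≈_ K (eval (principal n μ) ω) (fromℕ size)))
    -- The order d is 1 exactly when n divides k: then everything is fixed and ω is 1, otherwise
    -- nothing is fixed and the value vanishes.
    sieve k d order@(0<d , _ , least) with n ∣? k
    ... | yes (divides q refl) = length tabs ,
        (tabs , tableaux-unique n μ , (λ T → mk⇔
          (λ T∈ → fromTabs T∈ , ^^-multiple g n T (coxeter-order m T) q) (inTabs ∘ proj₁)) , refl) ,
        λ K _ ω prim → principal-at-one K (ω≈1 K prim)
      where
      d≡1 : d ≡ 1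
      d≡1 = ≤-antisym (least 1 z<s (subst (n ∣_) (sym (*-identityˡ k)) (n∣m*n q))) 0<d
      ω≈1 : ∀ K {ω} → InField.IsPrimitiveRoot K d ω → HeytingField._≈_ K ω (HeytingField.1# K)
      ω≈1 K {ω} (_ , ω^d≈1 , _) = K.trans (K.sym (K.*-identityʳ ω)) (subst (λ z → ω ^ z K.≈ K.1#) d≡1 ω^d≈1)
        where
        module K = HeytingField K
        open RawSemiringDefs (Semiring.rawSemiring (CommutativeRing.semiring (Evaluation.ring K))) using (_^_)
    ... | no n∤k = 0 ,
        ([] , [] , (λ T → mk⇔ (λ ()) (λ (x , eq) → ⊥-elim (n∤k (fixed⇒multiple k x eq)))) , refl) ,
        λ K _ ω prim → principal-at-root K (order-divides order) prim d≢1
      where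
      d≢1 : d ≢ 1
      d≢1 refl = n∤k (subst (n ∣_) (*-identityˡ k) (proj₁ (proj₂ order)))

theorem3p3 : ∀ {c ℓ₁ ℓ₂} (n : ℕ) (μ : List ℕ) →
    2 ≤ n → IsPartition μ → length μ < n → gcd n (sum μ) ≡ 1 →
    (∀ T → SST n μ T → Orbit (coxeter n) T HasSize n) ×
    (∃[ f ] ((q^ (κ μ)) *ₚ f ≈ₚ schur ℕ[q] n μ (λ k → q^ (k ∸ 1)) ×
    CyclicSieving c ℓ₁ ℓ₂ (SST n μ) n (coxeter n) f))
theorem3p3 (suc m) μ _ _ _ coprime =
  orbit-size m μ coprime , principal (suc m) μ , principal-schur m μ , cyclic-sieving m μ coprime
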